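{- Let $G$ be a graph with Gallai-Edmonds partition $V(G)=C(G)\cup A(G)\cup D(G)$, let $B_1,\dots,B_r$ be the connected components of $G[D(G)]$, let $k=|A(G)|$, and let $H$ be the associated bipartite multigraph (all defined in the context). For a maximum matching $M'$ of $H$, let $I(M')\subseteq\{1,\dots,r\}$ be the set of the $k$ indices $i$ such that the vertex $u_i$ of $H$ is covered by $M'$, and for $i\in I(M')$ let $w_i(M')\in V(B_i)$ be the endpoint in $B_i$ of the edge of $G$ corresponding to the edge of $M'$ covering $u_i$. Then the number $M_{\max}(G)$ of maximum matchings of $G$ is $$M_{\max}(G)=M_{pm}(G[C(G)])\times\Biggl[\sum_{M'}\Biggl(\ \prod_{i\in I(M')}M_{pm}\bigl(B_i-w_i(M')\bigr)\times\prod_{i\in\{1,\dots,r\}\setminus I(M')}\ \sum_{v\in V(B_i)}M_{pm}(B_i-v)\Biggr)\Biggr],$$ where the outer sum ranges over all maximum matchings $M'$ of $H$.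
   Context: Graphs are finite. A matching is a set of non-loop edges with no shared endpoints; a perfect matching saturates every vertex; a maximum matching is a matching of maximum size. $M_{\max}(\cdot)$ and $M_{pm}(\cdot)$ denote the numbers of maximum matchings and of perfect matchings respectively; the graph with no vertices has exactly one perfect matching, and empty products equal $1$. Gallai-Edmonds partition: $D(G)$ is the set of all vertices of $G$ not saturated by at least one maximum matching of $G$; $A(G)$ is the set of vertices in $V(G)\setminus D(G)$ having at least one neighbour in $D(G)$; $C(G)=V(G)\setminus(D(G)\cup A(G))$. The bipartite multigraph $H$ is obtained from $G$ by deleting the vertices of $C(G)$, deleting all edges with both endpoints in $A(G)$, and contracting each component $B_i$ of $G[D(G)]$ to a single vertex $u_i$; its parts are $A=A(G)$ and $B=\{u_1,\dots,u_r\}$. Parallel edges arising from the contraction are kept, so the edges of $H$ correspond bijectively to the edges of $G$ between $A(G)$ and $D(G)$, and matchings of $H$ are sets of such edges (two matchings using different parallel edges are different). By the Gallai-Edmonds structure theorem, every maximum matching of $H$ saturates all $k$ vertices of $A$, hence covers exactly $k$ of the vertices $u_1,\dots,u_r$. -}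

module Defs where

open import Data.Fin using (Fin; zero; suc; _↑ˡ_; _↑ʳ_)
open import Data.Fin.Properties using (any?; all?) renaming (_≟_ to _≟F_)
open import Data.Fin.Subset
  using (Subset; inside; outside; _∈_; ⊤; ⁅_⁆; ∁; _∩_; _∪_; _─_; ∣_∣)
open import Data.Fin.Subset.Properties using (_∈?_; anySubset?; ∈⊤; x∈p∩q⁺)
open import Data.List using (List; []; _∷_; length; filter) renaming (_++_ to _++ᴸ_; map to mapᴸ)
open import Data.Nat using (ℕ; zero; suc; _+_; _*_; _≤_)
open import Data.Nat.Properties using (_≤?_)
open import Data.Product using (∃; _×_; _,_; proj₁; proj₂)
open import Data.Product.Properties using (≡-dec)
open import Data.Sum using (_⊎_)
open import Data.Vec using ([]; _∷_; here; there; tabulate; _++_)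
open import Data.Vec.Properties
  using (lookup∘tabulate; lookup⇒[]=; []=⇒lookup; lookup-++ˡ; lookup-++ʳ)
open import Function using (_⇔_; Injective)
open import Relation.Binary.Construct.Closure.ReflexiveTransitive using (Star)
open import Relation.Binary.PropositionalEquality using (_≡_; sym; trans)
open import Relation.Nullary using (Dec; yes; no; ¬_; does)
open import Relation.Nullary.Decidable
  using (map′; ¬?; _×-dec_; _⊎-dec_; _→-dec_; dec-true; decidable-stable)
open import Relation.Unary using (Pred; Decidable)

------------------------------------------------------------------------
-- Subsets of Fin n

⟪_⟫ : ∀ {n p} {P : Pred (Fin n) p} → Decidable P → Subset n
⟪ P? ⟫ = tabulate (λ x → does (P? x))

module _ {n p} {P : Pred (Fin n) p} (P? : Decidable P) where

  ∈⟪⟫⁺ : ∀ {x} → P x → x ∈ ⟪ P? ⟫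
  ∈⟪⟫⁺ {x} px = lookup⇒[]= x _ (trans (lookup∘tabulate _ x) (dec-true (P? x) px))

  ∈⟪⟫⁻ : ∀ {x} → x ∈ ⟪ P? ⟫ → P x
  ∈⟪⟫⁻ {x} x∈ with P? x | trans (sym (lookup∘tabulate (λ y → does (P? y)) x)) ([]=⇒lookup x∈)
  ... | yes px | _  = px
  ... | no _   | ()

subsets : ∀ n → List (Subset n)
subsets zero    = [] ∷ []
subsets (suc n) = mapᴸ (inside ∷_) (subsets n) ++ᴸ mapᴸ (outside ∷_) (subsets n)

∑ : ∀ {n} (p : Subset n) → (∀ i → i ∈ p → ℕ) → ℕ
∑ []            f = 0
∑ (inside  ∷ p) f = f zero here + ∑ p (λ i i∈p → f (suc i) (there i∈p))
∑ (outside ∷ p) f = ∑ p (λ i i∈p → f (suc i) (there i∈p))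

∏ : ∀ {n} (p : Subset n) → (∀ i → i ∈ p → ℕ) → ℕ
∏ []            f = 1
∏ (inside  ∷ p) f = f zero here * ∏ p (λ i i∈p → f (suc i) (there i∈p))
∏ (outside ∷ p) f = ∏ p (λ i i∈p → f (suc i) (there i∈p))

------------------------------------------------------------------------
-- Finite graphs, with loops and parallel edges allowed

-- The vertex set is a subset of a pool of n names and the edge set a subset of
-- a pool of m names, so that subgraphs keep the names of their vertices and
-- edges. Graphs are undirected: the order of the two endpoints of an edge is
-- never used below. The endpoints of a name that is not an edge are junk.
record Graph (n m : ℕ) : Set where
  field
    vertices : Subset n
    edges    : Subset m
    ends     : Fin m → Fin n × Fin n
    closed   : ∀ {e} → e ∈ edges → proj₁ (ends e) ∈ vertices × proj₂ (ends e) ∈ vertices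

open Graph public

module _ {n m} (G : Graph n m) where

  Loop : Fin m → Set
  Loop e = proj₁ (ends G e) ≡ proj₂ (ends G e)

  Incident : Fin m → Fin n → Set
  Incident e v = proj₁ (ends G e) ≡ v ⊎ proj₂ (ends G e) ≡ v

  incident? : ∀ e v → Dec (Incident e v)
  incident? e v = (proj₁ (ends G e) ≟F v) ⊎-dec (proj₂ (ends G e) ≟F v)

  Within : Subset n → Fin m → Set
  Within S e = proj₁ (ends G e) ∈ S × proj₂ (ends G e) ∈ S

  within? : ∀ S e → Dec (Within S e)
  within? S e = (proj₁ (ends G e) ∈? S) ×-dec (proj₂ (ends G e) ∈? S)

  Adjacent : Fin n → Fin n → Set
  Adjacent u v = ∃ λ e → e ∈ edges G × (ends G e ≡ (u , v) ⊎ ends G e ≡ (v , u))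

  adjacent? : ∀ u v → Dec (Adjacent u v)
  adjacent? u v = any? λ e → (e ∈? edges G) ×-dec
    (≡-dec _≟F_ _≟F_ (ends G e) (u , v) ⊎-dec ≡-dec _≟F_ _≟F_ (ends G e) (v , u))

  IsComponent : Subset n → Set
  IsComponent S = ∃ λ v → v ∈ vertices G × (∀ u → u ∈ S ⇔ Star Adjacent v u)

  -- B lists the vertex sets of the connected components, without repetition.
  record IsComponentList {r} (B : Fin r → Subset n) : Set where
    field
      component : ∀ i → IsComponent (B i)
      distinct  : Injective _≡_ _≡_ B
      covering  : ∀ v → v ∈ vertices G → ∃ λ i → v ∈ B i

------------------------------------------------------------------------
-- Matchings

  record IsMatching (M : Subset m) : Set where
    field
      areEdges : ∀ e → e ∈ M → e ∈ edges G
      nonLoop  : ∀ e → e ∈ M → ¬ Loop e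
      disjoint : ∀ e f → e ∈ M → f ∈ M → ∀ v → Incident e v → Incident f v → e ≡ f

  isMatching? : Decidable IsMatching
  isMatching? M = map′
    (λ (a , b , c) → record { areEdges = a ; nonLoop = b ; disjoint = c })
    (λ μ → let open IsMatching μ in areEdges , nonLoop , disjoint)
    (all? (λ e → (e ∈? M) →-dec (e ∈? edges G))
      ×-dec all? (λ e → (e ∈? M) →-dec ¬? (proj₁ (ends G e) ≟F proj₂ (ends G e)))
      ×-dec all? (λ e → all? λ f → (e ∈? M) →-dec (f ∈? M) →-dec
              all? (λ v → incident? e v →-dec incident? f v →-dec (e ≟F f))))

  Saturates : Subset m → Fin n → Set
  Saturates M v = ∃ λ e → e ∈ M × Incident e v

  saturates? : ∀ M v → Dec (Saturates M v)
  saturates? M v = any? λ e → (e ∈? M) ×-dec incident? e v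

  IsPerfectMatching : Subset m → Set
  IsPerfectMatching M = IsMatching M × (∀ v → v ∈ vertices G → Saturates M v)

  isPerfectMatching? : Decidable IsPerfectMatching
  isPerfectMatching? M =
    isMatching? M ×-dec all? (λ v → (v ∈? vertices G) →-dec saturates? M v)

  IsMaximumMatching : Subset m → Set
  IsMaximumMatching M = IsMatching M × (∀ M′ → IsMatching M′ → ∣ M′ ∣ ≤ ∣ M ∣)

  isMaximumMatching? : Decidable IsMaximumMatching
  isMaximumMatching? M = isMatching? M ×-dec map′
    (λ none M′ μ → decidable-stable (∣ M′ ∣ ≤? ∣ M ∣) (λ ≰ → none (M′ , μ , ≰)))
    (λ max (M′ , μ , ≰) → ≰ (max M′ μ))
    (¬? (anySubset? λ M′ → isMatching? M′ ×-dec ¬? (∣ M′ ∣ ≤? ∣ M ∣)))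

  maximumMatchings : List (Subset m)
  maximumMatchings = filter isMaximumMatching? (subsets m)

  Mmax : ℕ
  Mmax = length maximumMatchings

  Mpm : ℕ
  Mpm = length (filter isPerfectMatching? (subsets m))

------------------------------------------------------------------------
-- Subgraphs

module _ {n m} (G : Graph n m) where

  infixl 9 _[_] _∖_ _−_

  _[_] : Subset n → Graph n m
  _[_] S = record
    { vertices = vertices G ∩ S
    ; edges    = ⟪ inner? ⟫
    ; ends     = ends G
    ; closed   = λ e∈ → let (e∈G , s∈S , t∈S) = ∈⟪⟫⁻ inner? e∈
                            (s∈G , t∈G)       = closed G e∈G
                        in x∈p∩q⁺ (s∈G , s∈S) , x∈p∩q⁺ (t∈G , t∈S)
    }
    where
    inner? : Decidable (λ e → e ∈ edges G × Within G S e)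
    inner? e = (e ∈? edges G) ×-dec within? G S e

  _∖_ : Subset n → Graph n m
  _∖_ S = _[_] (∁ S)

  _−_ : Fin n → Graph n m
  _−_ v = _∖_ ⁅ v ⁆

  deleteEdgesWithin : Subset n → Graph n m
  deleteEdgesWithin S = record
    { vertices = vertices G
    ; edges    = ⟪ kept? ⟫
    ; ends     = ends G
    ; closed   = λ e∈ → closed G (proj₁ (∈⟪⟫⁻ kept? e∈))
    }
    where
    kept? : Decidable (λ e → e ∈ edges G × ¬ Within G S e)
    kept? e = (e ∈? edges G) ×-dec ¬? (within? G S e)

------------------------------------------------------------------------
-- Contraction

-- Vertex names of the contracted graph: v ↑ˡ r is the old vertex v, and
-- n ↑ʳ i is the vertex to which the block B i is contracted.
module _ {n r} (B : Fin r → Subset n) where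

  inBlock? : ∀ v → Dec (∃ λ i → v ∈ B i)
  inBlock? v = any? (λ i → v ∈? B i)

  image : Fin n → Fin (n + r)
  image v with inBlock? v
  ... | yes (i , _) = n ↑ʳ i
  ... | no  _       = v ↑ˡ r

-- The blocks are assumed to be pairwise disjoint. Edges inside a block
-- disappear; all other edges are kept, under the same name.
module _ {n m r} (G : Graph n m) (B : Fin r → Subset n) where

  contract : Graph (n + r) m
  contract = record
    { vertices = ⟪ outer? ⟫ ++ ⊤
    ; edges    = ⟪ kept? ⟫
    ; ends     = λ e → image B (proj₁ (ends G e)) , image B (proj₂ (ends G e))
    ; closed   = λ e∈ → let (s∈G , t∈G) = closed G (proj₁ (∈⟪⟫⁻ kept? e∈))
                        in image∈ s∈G , image∈ t∈G
    }
    where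
    outer? : Decidable (λ v → v ∈ vertices G × ¬ (∃ λ i → v ∈ B i))
    outer? v = (v ∈? vertices G) ×-dec ¬? (inBlock? B v)

    kept? : Decidable (λ e → e ∈ edges G × ¬ (∃ λ i → Within G (B i) e))
    kept? e = (e ∈? edges G) ×-dec ¬? (any? λ i → within? G (B i) e)

    image∈ : ∀ {v} → v ∈ vertices G → image B v ∈ ⟪ outer? ⟫ ++ ⊤
    image∈ {v} v∈G with inBlock? B v
    ... | yes (i , _) = lookup⇒[]= _ _
      (trans (lookup-++ʳ ⟪ outer? ⟫ ⊤ i) ([]=⇒lookup {i = i} ∈⊤))
    ... | no  v∉B     = lookup⇒[]= _ _
      (trans (lookup-++ˡ ⟪ outer? ⟫ ⊤ v) ([]=⇒lookup (∈⟪⟫⁺ outer? (v∈G , v∉B))))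

------------------------------------------------------------------------
-- The Gallai–Edmonds partition

module _ {n m} (G : Graph n m) where

  D : Subset n
  D = ⟪ (λ v → (v ∈? vertices G) ×-dec
               anySubset? (λ M → isMaximumMatching? G M ×-dec ¬? (saturates? G M v))) ⟫

  A : Subset n
  A = ⟪ (λ v → (v ∈? vertices G ─ D) ×-dec any? (λ u → (u ∈? D) ×-dec adjacent? G v u)) ⟫

  C : Subset n
  C = vertices G ─ (D ∪ A)

module _ {n m r} (G : Graph n m) (B : Fin r → Subset n) where

  H : Graph (n + r) m
  H = contract (deleteEdgesWithin (G ∖ C G) (A G)) B

  covered? : ∀ (M′ : Subset m) (i : Fin r) → Dec (Saturates H M′ (n ↑ʳ i))
  covered? M′ i = saturates? H M′ (n ↑ʳ i)

  I : Subset m → Subset r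
  I M′ = ⟪ covered? M′ ⟫

  -- An edge of H is not inside a block, so at most one of its ends in G lies
  -- in B i; if the edge is incident to n ↑ʳ i in H, exactly one does.
  endIn : Fin r → Fin m → Fin n
  endIn i e with proj₁ (ends G e) ∈? B i
  ... | yes _ = proj₁ (ends G e)
  ... | no  _ = proj₂ (ends G e)

  -- If M′ is a matching of H, the edge of M′ covering n ↑ʳ i is unique.
  w : (M′ : Subset m) (i : Fin r) → i ∈ I M′ → Fin n
  w M′ i i∈I = endIn i (proj₁ (∈⟪⟫⁻ (covered? M′) i∈I))

-- If L and N are matchings such that L misses a vertex set X and N misses W, and
-- |X| + 2|L| < 2|N| + |W|, then some vertex is saturated by N, missed by L and not
-- in X (or L misses a vertex of W), and trading an edge of L for the N-edge at
-- that vertex brings L closer to N. Repeating this, L is improved: it comes to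
-- miss a vertex of W, or it gains an edge at the price of one vertex of X.
-- This exchange gives both halves of the Gallai–Edmonds theorem: Gallai's lemma
-- (a component of G[D] never has two vertices missed by one maximum matching of
-- G − A), and, by induction on |T|, that a matching missing T ⊆ A and a further
-- vertex outside D has fewer than ν(G) − |T| edges, so that ν(G − A) = ν(G) − |A|.
-- Hence the maximum matchings of G are exactly the unions of a perfect matching
-- of G[C], a maximum matching M′ of H, and for each block a perfect matching of
-- the block minus a vertex, which is prescribed if M′ covers the block and free
-- otherwise. The edge sets of these pieces are disjoint, so the counts multiply.

module Submission where

open import Defs
open import Algebra.Properties.CommutativeSemigroup using (x∙yz≈y∙xz)
open import Data.Bool using (true; false)
open import Data.Empty using (⊥-elim)
open import Data.Fin using (Fin; zero; suc; toℕ; _↑ˡ_; _↑ʳ_)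
open import Data.Fin.Properties using (any?; all?; suc-injective; ↑ˡ-injective; ↑ʳ-injective; _≟_)
open import Data.Fin.Subset
  using (Subset; inside; outside; _∈_; _∉_; _⊆_; _⊂_; ⊤; ⊥; ⁅_⁆; ∁; _∩_; _∪_; _─_; _-_; ∣_∣; Empty)
open import Data.Fin.Subset.Properties
open import Data.List using (List; []; _∷_; length; filter; map) renaming (_++_ to _++ᴸ_)
open import Data.List.Properties using (map-++; map-∘; map-cong-local; filter-≐)
open import Data.List.Relation.Unary.All as All using ()
open import Data.List.Relation.Unary.All.Properties using (all-filter)
open import Data.Nat using (ℕ; zero; suc; _+_; _*_; _∸_; _≤_; _<_; z≤n; s≤s)
open import Data.Nat.ListAction using (sum)
open import Data.Nat.ListAction.Properties using (sum-++)
open import Data.Nat.Properties hiding (_≟_; suc-injective)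
open import Data.Nat.Tactic.RingSolver using (solve-∀)
open import Data.Product using (∃; _×_; _,_; proj₁; proj₂)
open import Data.Sum using (_⊎_; inj₁; inj₂; [_,_]′)
open import Data.Vec using ([]; _∷_; here; there; _++_)
open import Function using (_∘_; id; Equivalence)
open import Relation.Binary.Construct.Closure.ReflexiveTransitive using (Star; ε; _◅_; _◅◅_; reverse)
open import Relation.Binary.PropositionalEquality hiding ([_])
open import Relation.Nullary using (Dec; yes; no; ¬_; _because_; contradiction)
open import Relation.Nullary.Decidable using (map′; _×-dec_; _→-dec_; ¬?; decidable-stable)
open import Relation.Unary using (Pred; Decidable)

-- Membership and cardinality in finite subsets.

x∈p─q⇒x∉q : ∀ {n} {x : Fin n} (p q : Subset n) → x ∈ p ─ q → x ∉ q
x∈p─q⇒x∉q (_ ∷ p) (inside  ∷ q) (there x∈) (there x∈q) = x∈p─q⇒x∉q p q x∈ x∈q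
x∈p─q⇒x∉q (_ ∷ p) (outside ∷ q) (there x∈) (there x∈q) = x∈p─q⇒x∉q p q x∈ x∈q

x∈p-y⇒x∈p : ∀ {n} {x y : Fin n} (p : Subset n) → x ∈ p - y → x ∈ p
x∈p-y⇒x∈p {y = y} p = p─q⊆p p ⁅ y ⁆

x∈p-y⇒x≢y : ∀ {n} {x y : Fin n} (p : Subset n) → x ∈ p - y → x ≢ y
x∈p-y⇒x≢y {y = y} p x∈ refl = x∈p─q⇒x∉q p ⁅ y ⁆ x∈ (x∈⁅x⁆ y)

∣p∪⁅x⁆∣ : ∀ {n} (p : Subset n) {x} → x ∉ p → ∣ p ∪ ⁅ x ⁆ ∣ ≡ suc ∣ p ∣
∣p∪⁅x⁆∣ (inside  ∷ p) {zero}  x∉ = ⊥-elim (x∉ here)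
∣p∪⁅x⁆∣ (outside ∷ p) {zero}  x∉ = cong (suc ∘ ∣_∣) (∪-identityʳ p)
∣p∪⁅x⁆∣ (inside  ∷ p) {suc x} x∉ = cong suc (∣p∪⁅x⁆∣ p (x∉ ∘ there))
∣p∪⁅x⁆∣ (outside ∷ p) {suc x} x∉ = ∣p∪⁅x⁆∣ p (x∉ ∘ there)

∣p-x∣ : ∀ {n} (p : Subset n) {x} → x ∈ p → suc ∣ p - x ∣ ≡ ∣ p ∣
∣p-x∣ (inside  ∷ p) {zero}  here       = cong (suc ∘ ∣_∣) (p─⊥≡p p)
∣p-x∣ (inside  ∷ p) {suc x} (there x∈) = cong suc (∣p-x∣ p x∈)
∣p-x∣ (outside ∷ p) {suc x} (there x∈) = ∣p-x∣ p x∈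

∣p∩q∣+∣p∩∁q∣ : ∀ {n} (p q : Subset n) → ∣ p ∩ q ∣ + ∣ p ∩ ∁ q ∣ ≡ ∣ p ∣
∣p∩q∣+∣p∩∁q∣ []            []            = refl
∣p∩q∣+∣p∩∁q∣ (inside  ∷ p) (inside  ∷ q) = cong suc (∣p∩q∣+∣p∩∁q∣ p q)
∣p∩q∣+∣p∩∁q∣ (inside  ∷ p) (outside ∷ q) =
  trans (+-suc ∣ p ∩ q ∣ _) (cong suc (∣p∩q∣+∣p∩∁q∣ p q))
∣p∩q∣+∣p∩∁q∣ (outside ∷ p) (_       ∷ q) = ∣p∩q∣+∣p∩∁q∣ p q

disjoint⇒∣p∪q∣ : ∀ {n} (p q : Subset n) → (∀ {x} → x ∈ p → x ∉ q) → ∣ p ∪ q ∣ ≡ ∣ p ∣ + ∣ q ∣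
disjoint⇒∣p∪q∣ []            []            _  = refl
disjoint⇒∣p∪q∣ (inside  ∷ p) (inside  ∷ q) pq = ⊥-elim (pq here here)
disjoint⇒∣p∪q∣ (inside  ∷ p) (outside ∷ q) pq =
  cong suc (disjoint⇒∣p∪q∣ p q λ x∈p x∈q → pq (there x∈p) (there x∈q))
disjoint⇒∣p∪q∣ (outside ∷ p) (inside  ∷ q) pq =
  trans (cong suc (disjoint⇒∣p∪q∣ p q λ x∈p x∈q → pq (there x∈p) (there x∈q))) (sym (+-suc ∣ p ∣ _))
disjoint⇒∣p∪q∣ (outside ∷ p) (outside ∷ q) pq =
  disjoint⇒∣p∪q∣ p q λ x∈p x∈q → pq (there x∈p) (there x∈q)

∣p++⊥∣ : ∀ {n} (p : Subset n) r → ∣ p ++ ⊥ {r} ∣ ≡ ∣ p ∣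
∣p++⊥∣ []            r = ∣⊥∣≡0 r
∣p++⊥∣ (inside  ∷ p) r = cong suc (∣p++⊥∣ p r)
∣p++⊥∣ (outside ∷ p) r = ∣p++⊥∣ p r

∈-++⁺ˡ : ∀ {n r} {p : Subset n} {q : Subset r} {x} → x ∈ p → x ↑ˡ r ∈ p ++ q
∈-++⁺ˡ here       = here
∈-++⁺ˡ (there x∈) = there (∈-++⁺ˡ x∈)

↑ˡ≢↑ʳ : ∀ {n r} (x : Fin n) (i : Fin r) → x ↑ˡ r ≢ n ↑ʳ i
↑ˡ≢↑ʳ zero    i ()
↑ˡ≢↑ʳ (suc x) i eq = ↑ˡ≢↑ʳ x i (suc-injective eq)

-- The graph operation `_−_` deletes a vertex by intersecting with `∁ ⁅ x ⁆`, so orders of such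
-- graphs are needed in this form rather than for `p - x`.
∣p∩∁⁅x⁆∣ : ∀ {n} (p : Subset n) {x} → x ∈ p → suc ∣ p ∩ ∁ ⁅ x ⁆ ∣ ≡ ∣ p ∣
∣p∩∁⁅x⁆∣ p {x} x∈p = trans (cong (_+ ∣ p ∩ ∁ ⁅ x ⁆ ∣) (sym singleton)) (∣p∩q∣+∣p∩∁q∣ p ⁅ x ⁆)
  where
  singleton : ∣ p ∩ ⁅ x ⁆ ∣ ≡ 1
  singleton = trans (cong ∣_∣ (⊆-antisym (p∩q⊆q p ⁅ x ⁆)
    (λ y∈ → x∈p∩q⁺ (subst (_∈ p) (sym (x∈⁅y⁆⇒x≡y x y∈)) x∈p , y∈)))) (∣⁅x⁆∣≡1 x)

-- Edge sets cut along a disjoint family of pieces.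

Covered : ∀ {m k} → (Fin k → Subset m) → Subset m → Set
Covered E M = ∀ e → e ∈ M → ∃ λ c → e ∈ E c

Disjoint : ∀ {m k} → (Fin k → Subset m) → Set
Disjoint E = ∀ {c d e} → e ∈ E c → e ∈ E d → c ≡ d

Covered-merge : ∀ {m k} (E : Fin (suc k) → Subset m) M → Covered (E ∘ suc) (M ∩ ∁ (E zero)) → Covered E M
Covered-merge E M cov e e∈M with e ∈? E zero
... | yes e∈E = zero , e∈E
... | no  e∉E = let c , e∈ = cov e (x∈p∩q⁺ (e∈M , x∉p⇒x∈∁p e∉E)) in suc c , e∈

module _ {m k} (E : Fin (suc k) → Subset m) (E-disjoint : Disjoint E) (M : Subset m) where

  Covered-rest : Covered E M → Covered (E ∘ suc) (M ∩ ∁ (E zero))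
  Covered-rest cov e e∈ with x∈p∩q⁻ _ _ e∈
  ... | e∈M , e∉ with cov e e∈M
  ... | zero  , e∈E = ⊥-elim (x∈∁p⇒x∉p e∉ e∈E)
  ... | suc c , e∈E = c , e∈E

  -- By disjointness the later pieces contain nothing of piece `zero`, so peeling that piece off
  -- leaves them intact. This carries the inductions on the number of pieces.
  ∩-rest : ∀ c → (M ∩ ∁ (E zero)) ∩ E (suc c) ≡ M ∩ E (suc c)
  ∩-rest c = ⊆-antisym
    (λ x∈ → let x∈M∩ , x∈E = x∈p∩q⁻ _ _ x∈
            in x∈p∩q⁺ (proj₁ (x∈p∩q⁻ _ _ x∈M∩) , x∈E))
    (λ x∈ → let x∈M , x∈E = x∈p∩q⁻ _ _ x∈
            in x∈p∩q⁺ (x∈p∩q⁺ (x∈M , x∉p⇒x∈∁p (λ x∈E₀ → 0≢1+n (cong toℕ (E-disjoint x∈E₀ x∈E)))) , x∈E))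

-- Cardinality is additive over disjoint pieces; phrasing this as a comparison avoids a closed
-- formula for the total size.
∣∣-piecewise : ∀ {m k} (E : Fin k → Subset m) → Disjoint E → ∀ {M N} → Covered E M → Covered E N →
               (∀ c → ∣ M ∩ E c ∣ ≡ ∣ N ∩ E c ∣) → ∣ M ∣ ≡ ∣ N ∣
∣∣-piecewise {k = zero}  E E-disjoint covM covN eq =
  cong ∣_∣ (trans (Empty-unique (empty covM)) (sym (Empty-unique (empty covN))))
  where
  empty : ∀ {M} → Covered E M → Empty M
  empty cov (e , e∈) with cov e e∈
  ... | () , _
∣∣-piecewise {k = suc k} E E-disjoint {M} {N} covM covN eq = begin
  ∣ M ∣                                      ≡⟨ ∣p∩q∣+∣p∩∁q∣ M (E zero) ⟨
  ∣ M ∩ E zero ∣ + ∣ M ∩ ∁ (E zero) ∣        ≡⟨ cong₂ _+_ (eq zero) (∣∣-piecewise (E ∘ suc)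
                                                  (λ x∈ y∈ → suc-injective (E-disjoint x∈ y∈))
                                                  (Covered-rest E E-disjoint M covM)
                                                  (Covered-rest E E-disjoint N covN) rest) ⟩
  ∣ N ∩ E zero ∣ + ∣ N ∩ ∁ (E zero) ∣        ≡⟨ ∣p∩q∣+∣p∩∁q∣ N (E zero) ⟩
  ∣ N ∣                                      ∎
  where
  open ≡-Reasoning
  rest : ∀ c → ∣ (M ∩ ∁ (E zero)) ∩ E (suc c) ∣ ≡ ∣ (N ∩ ∁ (E zero)) ∩ E (suc c) ∣
  rest c = trans (cong ∣_∣ (∩-rest E E-disjoint M c))
                 (trans (eq (suc c)) (cong ∣_∣ (sym (∩-rest E E-disjoint N c))))

-- Sums over the subsets of a given set.

Σ⊆ : ∀ {m} → Subset m → (Subset m → ℕ) → ℕ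
Σ⊆ []            f = f []
Σ⊆ (inside  ∷ E) f = Σ⊆ E (f ∘ (inside ∷_)) + Σ⊆ E (f ∘ (outside ∷_))
Σ⊆ (outside ∷ E) f = Σ⊆ E (f ∘ (outside ∷_))

Σ⊆-cong : ∀ {m} (E : Subset m) {f g} → (∀ p → p ⊆ E → f p ≡ g p) → Σ⊆ E f ≡ Σ⊆ E g
Σ⊆-cong []            eq = eq [] (λ ())
Σ⊆-cong (inside  ∷ E) eq = cong₂ _+_ (Σ⊆-cong E λ p p⊆ → eq (inside ∷ p) (in⊆in p⊆))
                                     (Σ⊆-cong E λ p p⊆ → eq (outside ∷ p) (out⊆ p⊆))
Σ⊆-cong (outside ∷ E) eq = Σ⊆-cong E λ p p⊆ → eq (outside ∷ p) (out⊆ p⊆)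

+-interchange : ∀ a b c d → (a + b) + (c + d) ≡ (a + c) + (b + d)
+-interchange = solve-∀

Σ⊆-+ : ∀ {m} (E : Subset m) f g → Σ⊆ E (λ p → f p + g p) ≡ Σ⊆ E f + Σ⊆ E g
Σ⊆-+ []            f g = refl
Σ⊆-+ (inside  ∷ E) f g =
  trans (cong₂ _+_ (Σ⊆-+ E _ _) (Σ⊆-+ E _ _)) (+-interchange (Σ⊆ E (f ∘ (inside ∷_))) _ _ _)
Σ⊆-+ (outside ∷ E) f g = Σ⊆-+ E _ _

Σ⊆-* : ∀ {m} (E : Subset m) c f → Σ⊆ E (λ p → c * f p) ≡ c * Σ⊆ E f
Σ⊆-* []            c f = refl
Σ⊆-* (inside  ∷ E) c f =
  trans (cong₂ _+_ (Σ⊆-* E c _) (Σ⊆-* E c _)) (sym (*-distribˡ-+ c _ _))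
Σ⊆-* (outside ∷ E) c f = Σ⊆-* E c _

Σ⊆-zero : ∀ {m} (E : Subset m) {f} → (∀ p → f p ≡ 0) → Σ⊆ E f ≡ 0
Σ⊆-zero E {f} eq = trans (Σ⊆-cong E (λ p _ → eq p)) (Σ⊆-* E 0 f)

-- Where `E` has an outside bit, the sets containing that element are not contained in `E`, so their
-- half of the sum vanishes.
Σ⊆-support : ∀ {m} (E : Subset m) f → (∀ p → ¬ p ⊆ E → f p ≡ 0) → Σ⊆ ⊤ f ≡ Σ⊆ E f
Σ⊆-support []            f supp = refl
Σ⊆-support (inside  ∷ E) f supp = cong₂ _+_
  (Σ⊆-support E _ λ p p⊈ → supp (inside ∷ p) (p⊈ ∘ drop-∷-⊆))
  (Σ⊆-support E _ λ p p⊈ → supp (outside ∷ p) (p⊈ ∘ drop-∷-⊆))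
Σ⊆-support (outside ∷ E) f supp = cong₂ _+_
  (Σ⊆-zero ⊤ λ p → supp (inside ∷ p) (λ p⊆ → contradiction (p⊆ here) λ ()))
  (Σ⊆-support E _ λ p p⊈ → supp (outside ∷ p) (p⊈ ∘ drop-∷-⊆))

-- A set is the union of its parts in `E` and in `∁ E`. At each bit exactly one of the nested sums
-- branches; if it is the inner one, `Σ⊆-+` moves the addition outwards.
Σ⊆-split : ∀ {m} (E : Subset m) f → Σ⊆ ⊤ f ≡ Σ⊆ E (λ p → Σ⊆ (∁ E) (λ q → f (p ∪ q)))
Σ⊆-split []            f = refl
Σ⊆-split (inside  ∷ E) f = cong₂ _+_ (Σ⊆-split E _) (Σ⊆-split E _)
Σ⊆-split (outside ∷ E) f = trans (cong₂ _+_ (Σ⊆-split E _) (Σ⊆-split E _)) (sym (Σ⊆-+ E _ _))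

-- Counting subsets through sums of indicators.

count : ∀ {m ℓ} {P : Pred (Subset m) ℓ} → Decidable P → ℕ
count {m} P? = length (filter P? (subsets m))

indicator : ∀ {ℓ} {P : Set ℓ} → Dec P → ℕ
indicator (true  because _) = 1
indicator (false because _) = 0

indicator-true : ∀ {ℓ} {P : Set ℓ} (P? : Dec P) → P → indicator P? ≡ 1
indicator-true (yes _) _ = refl
indicator-true (no ¬p) p = contradiction p ¬p

indicator-false : ∀ {ℓ} {P : Set ℓ} (P? : Dec P) → ¬ P → indicator P? ≡ 0
indicator-false (yes p) ¬p = contradiction p ¬p
indicator-false (no _)  _  = refl

indicator-map′ : ∀ {ℓ ℓ′} {P : Set ℓ} {Q : Set ℓ′} {to : P → Q} {from : Q → P} (P? : Dec P) →
                 indicator P? ≡ indicator (map′ to from P?)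
indicator-map′ (yes _) = refl
indicator-map′ (no _)  = refl

module _ {m ℓ} {P : Pred (Subset m) ℓ} (P? : Decidable P) where

  sum-filter : ∀ (g : Subset m → ℕ) xs →
               sum (map g (filter P? xs)) ≡ sum (map (λ p → indicator (P? p) * g p) xs)
  sum-filter g []       = refl
  sum-filter g (x ∷ xs) with P? x
  ... | yes _ = cong₂ _+_ (sym (+-identityʳ (g x))) (sum-filter g xs)
  ... | no  _ = sum-filter g xs

  length-filter : ∀ xs → length (filter P? xs) ≡ sum (map (λ p → indicator (P? p)) xs)
  length-filter []       = refl
  length-filter (x ∷ xs) with P? x
  ... | yes _ = cong suc (length-filter xs)
  ... | no  _ = length-filter xs

sum-subsets : ∀ m (f : Subset m → ℕ) → sum (map f (subsets m)) ≡ Σ⊆ ⊤ f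
sum-subsets zero    f = +-identityʳ (f [])
sum-subsets (suc m) f = begin
  sum (map f (map (inside ∷_) ps ++ᴸ map (outside ∷_) ps))
    ≡⟨ cong sum (map-++ f (map (inside ∷_) ps) _) ⟩
  sum (map f (map (inside ∷_) ps) ++ᴸ map f (map (outside ∷_) ps))
    ≡⟨ sum-++ (map f (map (inside ∷_) ps)) _ ⟩
  sum (map f (map (inside ∷_) ps)) + sum (map f (map (outside ∷_) ps))
    ≡⟨ cong₂ (λ xs ys → sum xs + sum ys) (map-∘ ps) (map-∘ ps) ⟨
  sum (map (f ∘ (inside ∷_)) ps) + sum (map (f ∘ (outside ∷_)) ps)
    ≡⟨ cong₂ _+_ (sum-subsets m _) (sum-subsets m _) ⟩
  Σ⊆ ⊤ (f ∘ (inside ∷_)) + Σ⊆ ⊤ (f ∘ (outside ∷_)) ∎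
  where
  open ≡-Reasoning
  ps = subsets m

count≡Σ⊆ : ∀ {m ℓ} {P : Pred (Subset m) ℓ} (P? : Decidable P) →
           count P? ≡ Σ⊆ ⊤ (λ p → indicator (P? p))
count≡Σ⊆ {m} P? = trans (length-filter P? (subsets m)) (sum-subsets m _)

count-cong : ∀ {m ℓ₁ ℓ₂} {P : Pred (Subset m) ℓ₁} {Q : Pred (Subset m) ℓ₂}
             (P? : Decidable P) (Q? : Decidable Q) →
             (∀ {M} → P M → Q M) → (∀ {M} → Q M → P M) → count P? ≡ count Q?
count-cong {m} P? Q? P⇒Q Q⇒P = cong length (filter-≐ P? Q? (P⇒Q , Q⇒P) (subsets m))

module _ {m ℓ₁ ℓ₂ ℓ₃} {P : Pred (Subset m) ℓ₁} {Q : Pred (Subset m) ℓ₂} {R : Subset m → Pred (Subset m) ℓ₃}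
         (P? : Decidable P) (Q? : Decidable Q) (R? : ∀ p → Decidable (R p)) (E : Subset m)
         (Q⊆E : ∀ {p} → Q p → p ⊆ E) (R⊆∁E : ∀ {p q} → R p q → q ⊆ ∁ E)
         (P⇒Q : ∀ {M} → P M → Q (M ∩ E)) (P⇒R : ∀ {M} → P M → R (M ∩ E) (M ∩ ∁ E))
         (QR⇒P : ∀ {M} → Q (M ∩ E) → R (M ∩ E) (M ∩ ∁ E) → P M) where

  private
    open ≡-Reasoning

    ∩E : ∀ {p q} → p ⊆ E → q ⊆ ∁ E → (p ∪ q) ∩ E ≡ p
    ∩E {p} {q} p⊆ q⊆ = ⊆-antisym
      (λ x∈ → let x∈∪ , x∈E = x∈p∩q⁻ _ _ x∈ in
              [ id , (λ x∈q → ⊥-elim (x∈∁p⇒x∉p (q⊆ x∈q) x∈E)) ]′ (x∈p∪q⁻ p q x∈∪))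
      (λ x∈ → x∈p∩q⁺ (x∈p∪q⁺ (inj₁ x∈) , p⊆ x∈))

    ∩∁E : ∀ {p q} → p ⊆ E → q ⊆ ∁ E → (p ∪ q) ∩ ∁ E ≡ q
    ∩∁E {p} {q} p⊆ q⊆ = ⊆-antisym
      (λ x∈ → let x∈∪ , x∈E = x∈p∩q⁻ _ _ x∈ in
              [ (λ x∈p → ⊥-elim (x∈∁p⇒x∉p x∈E (p⊆ x∈p))) , id ]′ (x∈p∪q⁻ p q x∈∪))
      (λ x∈ → x∈p∩q⁺ (x∈p∪q⁺ (inj₂ x∈) , q⊆ x∈))

    indicator-split : ∀ p → p ⊆ E → ∀ q → q ⊆ ∁ E →
                      indicator (P? (p ∪ q)) ≡ indicator (Q? p) * indicator (R? p q)
    indicator-split p p⊆ q q⊆ with Q? p | R? p q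
    ... | yes Qp | yes Rpq = indicator-true (P? _)
      (QR⇒P (subst Q (sym (∩E p⊆ q⊆)) Qp) (subst₂ R (sym (∩E p⊆ q⊆)) (sym (∩∁E p⊆ q⊆)) Rpq))
    ... | yes _  | no ¬Rpq = indicator-false (P? _)
      (λ Pp → ¬Rpq (subst₂ R (∩E p⊆ q⊆) (∩∁E p⊆ q⊆) (P⇒R Pp)))
    ... | no ¬Qp | _       = indicator-false (P? _) (λ Pp → ¬Qp (subst Q (∩E p⊆ q⊆) (P⇒Q Pp)))

  -- A set `M` corresponds to the pair of its traces on `E` and `∁ E`, so the count is a double sum
  -- of products of indicators. `R` may depend on the first trace because the part of a matching in
  -- `H` constrains its parts in the blocks.
  count-split : count P? ≡ sum (map (λ p → count (R? p)) (filter Q? (subsets m)))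
  count-split = begin
    count P?
      ≡⟨ count≡Σ⊆ P? ⟩
    Σ⊆ ⊤ (λ M → indicator (P? M))
      ≡⟨ Σ⊆-split E _ ⟩
    Σ⊆ E (λ p → Σ⊆ (∁ E) (λ q → indicator (P? (p ∪ q))))
      ≡⟨ (Σ⊆-cong E λ p p⊆ → Σ⊆-cong (∁ E) λ q q⊆ → indicator-split p p⊆ q q⊆) ⟩
    Σ⊆ E (λ p → Σ⊆ (∁ E) (λ q → indicator (Q? p) * indicator (R? p q)))
      ≡⟨ (Σ⊆-cong E λ p _ → Σ⊆-* (∁ E) (indicator (Q? p)) _) ⟩
    Σ⊆ E (λ p → indicator (Q? p) * Σ⊆ (∁ E) (λ q → indicator (R? p q)))
      -- Here and in the next step the range of summation grows back to all subsets, which adds only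
      -- zeros since `R p` forces sets inside `∁ E` and `Q` forces sets inside `E`.
      ≡⟨ (Σ⊆-cong E λ p _ → cong (indicator (Q? p) *_) (trans (count≡Σ⊆ (R? p))
           (Σ⊆-support (∁ E) _ λ q q⊈ → indicator-false (R? p q) λ Rpq → q⊈ (R⊆∁E Rpq)))) ⟨
    Σ⊆ E (λ p → indicator (Q? p) * count (R? p))
      ≡⟨ (Σ⊆-support E _ λ p p⊈ → cong (_* count (R? p)) (indicator-false (Q? p) λ Qp → p⊈ (Q⊆E Qp))) ⟨
    Σ⊆ ⊤ (λ p → indicator (Q? p) * count (R? p))
      ≡⟨ sum-subsets m _ ⟨
    sum (map (λ p → indicator (Q? p) * count (R? p)) (subsets m))
      ≡⟨ sum-filter Q? _ (subsets m) ⟨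
    sum (map (λ p → count (R? p)) (filter Q? (subsets m))) ∎

-- Independent conditions on the pieces.

module _ {m k ℓ} (E : Fin k → Subset m) {Q : Fin k → Pred (Subset m) ℓ} where

  Piecewise : Pred (Subset m) ℓ
  Piecewise M = Covered E M × (∀ c → Q c (M ∩ E c))

  piecewise? : (∀ c → Decidable (Q c)) → Decidable Piecewise
  piecewise? Q? M = (all? λ e → (e ∈? M) →-dec any? λ c → e ∈? E c) ×-dec all? λ c → Q? c (M ∩ E c)

sum-map-* : ∀ {a} {X : Set a} c (f : X → ℕ) xs → sum (map (λ x → c * f x) xs) ≡ c * sum (map f xs)
sum-map-* c f []       = sym (*-zeroʳ c)
sum-map-* c f (x ∷ xs) = trans (cong (c * f x +_) (sum-map-* c f xs)) (sym (*-distribˡ-+ c (f x) _))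

sum-map-const : ∀ {a} {X : Set a} c (xs : List X) → sum (map (λ _ → c) xs) ≡ length xs * c
sum-map-const c []       = refl
sum-map-const c (_ ∷ xs) = cong (c +_) (sum-map-const c xs)

-- The conditions on the later pieces ignore the choice in the first one, so `count-split` sums a
-- constant and the counts multiply.
count-piecewise : ∀ {m k ℓ} (E : Fin k → Subset m) {Q : Fin k → Pred (Subset m) ℓ}
                  (Q? : ∀ c → Decidable (Q c)) → Disjoint E → (∀ {c p} → Q c p → p ⊆ E c) →
                  count (piecewise? E Q?) ≡ ∏ ⊤ (λ c _ → count (Q? c))
count-piecewise {m} {zero} E Q? E-disjoint Q⊆E =
  -- A set covered by an empty family is empty, so exactly `⊥` is counted, in agreement with the
  -- empty product.
  trans (count≡Σ⊆ (piecewise? E Q?))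
        (trans (Σ⊆-support ⊥ _ λ p p⊈ → indicator-false (piecewise? E Q? p)
                  λ (cov , _) → p⊈ λ x∈p → ⊥-elim (noPiece (cov _ x∈p)))
               (trans (Σ⊆-⊥ m) (indicator-true (piecewise? E Q? ⊥) ((λ e e∈ → ⊥-elim (∉⊥ e∈)) , λ ()))))
  where
  noPiece : ∀ {e} → ¬ (∃ λ c → e ∈ E c)
  noPiece (() , _)
  Σ⊆-⊥ : ∀ m {f} → Σ⊆ {m} ⊥ f ≡ f ⊥
  Σ⊆-⊥ zero    = refl
  Σ⊆-⊥ (suc m) = Σ⊆-⊥ m
count-piecewise {k = suc k} E {Q} Q? E-disjoint Q⊆E = begin
  count (piecewise? E Q?)
    ≡⟨ count-split (piecewise? E Q?) (Q? zero) (λ _ → piecewise? (E ∘ suc) (Q? ∘ suc)) (E zero)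
         Q⊆E
         (λ (cov , _) x∈ → let c , x∈E = cov _ x∈ in
            x∉p⇒x∈∁p (λ x∈E₀ → 0≢1+n (cong toℕ (E-disjoint x∈E₀ x∈E))))
         (λ (_ , q) → q zero)
         (λ {M} (cov , q) → Covered-rest E E-disjoint M cov
                          , λ c → subst (Q (suc c)) (sym (∩-rest E E-disjoint M c)) (q (suc c)))
         (λ {M} q₀ (cov , q) → Covered-merge E M cov
                             , λ { zero → q₀ ; (suc c) → subst (Q (suc c)) (∩-rest E E-disjoint M c) (q c) }) ⟩
  sum (map (λ _ → count (piecewise? (E ∘ suc) (Q? ∘ suc))) (filter (Q? zero) (subsets _)))
    ≡⟨ sum-map-const _ (filter (Q? zero) (subsets _)) ⟩
  count (Q? zero) * count (piecewise? (E ∘ suc) (Q? ∘ suc))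
    ≡⟨ cong (count (Q? zero) *_) (count-piecewise (E ∘ suc) (Q? ∘ suc)
         (λ x∈ y∈ → suc-injective (E-disjoint x∈ y∈)) Q⊆E) ⟩
  count (Q? zero) * ∏ ⊤ (λ c _ → count (Q? (suc c))) ∎
  where
  open ≡-Reasoning

-- Mutually exclusive alternatives, and products over complementary index sets.

∑-cong : ∀ {n} (p : Subset n) {f g : ∀ i → i ∈ p → ℕ} → (∀ i i∈ → f i i∈ ≡ g i i∈) → ∑ p f ≡ ∑ p g
∑-cong []            eq = refl
∑-cong (inside  ∷ p) eq = cong₂ _+_ (eq zero here) (∑-cong p λ i i∈ → eq (suc i) (there i∈))
∑-cong (outside ∷ p) eq = ∑-cong p λ i i∈ → eq (suc i) (there i∈)

-- Uniqueness of the witness makes the families for different `v` disjoint, so counting their union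
-- adds the counts. It will be applied with `v` the vertex of a block that a near-perfect matching
-- leaves out.
count-∃ : ∀ {n m ℓ} (p : Subset n) {P : Fin n → Pred (Subset m) ℓ} (P? : ∀ v → Decidable (P v)) →
          (∀ {u v M} → u ∈ p → v ∈ p → P u M → P v M → u ≡ v) →
          count (λ M → any? (λ v → (v ∈? p) ×-dec P? v M)) ≡ ∑ p (λ v _ → count (P? v))
count-∃ {m = m} p {P} P? unique = begin
  count (λ M → any? (λ v → (v ∈? p) ×-dec P? v M))
    ≡⟨ count≡Σ⊆ (λ M → any? (λ v → (v ∈? p) ×-dec P? v M)) ⟩
  Σ⊆ ⊤ (λ M → indicator (any? (λ v → (v ∈? p) ×-dec P? v M)))
    ≡⟨ Σ⊆-cong ⊤ (λ M _ → indicator-∃ p (λ v → P? v M) unique (any? _)) ⟩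
  Σ⊆ ⊤ (λ M → ∑ p (λ v _ → indicator (P? v M)))
    ≡⟨ swap p (λ v M → indicator (P? v M)) ⟩
  ∑ p (λ v _ → Σ⊆ ⊤ (λ M → indicator (P? v M)))
    ≡⟨ ∑-cong p (λ v _ → count≡Σ⊆ (P? v)) ⟨
  ∑ p (λ v _ → count (P? v)) ∎
  where
  open ≡-Reasoning
  ∑-zero : ∀ {n} (p : Subset n) {f : ∀ i → i ∈ p → ℕ} → (∀ i i∈ → f i i∈ ≡ 0) → ∑ p f ≡ 0
  ∑-zero []            eq = refl
  ∑-zero (inside  ∷ p) eq = cong₂ _+_ (eq zero here) (∑-zero p λ i i∈ → eq (suc i) (there i∈))
  ∑-zero (outside ∷ p) eq = ∑-zero p λ i i∈ → eq (suc i) (there i∈)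

  swap : ∀ {n} (p : Subset n) (f : Fin n → Subset m → ℕ) →
         Σ⊆ ⊤ (λ M → ∑ p (λ v _ → f v M)) ≡ ∑ p (λ v _ → Σ⊆ ⊤ (f v))
  swap []            f = Σ⊆-zero {m} ⊤ λ _ → refl
  swap (inside  ∷ p) f = trans (Σ⊆-+ ⊤ (f zero) _) (cong (Σ⊆ ⊤ (f zero) +_) (swap p (f ∘ suc)))
  swap (outside ∷ p) f = swap p (f ∘ suc)

  -- The decision `∃?` is arbitrary, so that the induction can pass to the tail of `p` with a
  -- decision transported by `map′`.
  indicator-∃ : ∀ {n ℓ} (p : Subset n) {X : Fin n → Set ℓ} (X? : ∀ v → Dec (X v)) →
                (∀ {u v} → u ∈ p → v ∈ p → X u → X v → u ≡ v) →
                (∃? : Dec (∃ λ v → v ∈ p × X v)) → indicator ∃? ≡ ∑ p (λ v _ → indicator (X? v))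
  indicator-∃ [] X? uniq ∃? = indicator-false ∃? λ { (() , _) }
  indicator-∃ (outside ∷ p) {X} X? uniq ∃? = trans (indicator-map′ ∃?)
    (indicator-∃ p (X? ∘ suc) (λ u∈ v∈ x y → suc-injective (uniq (there u∈) (there v∈) x y)) (map′ to from ∃?))
    where
    to : (∃ λ v → v ∈ outside ∷ p × X v) → ∃ λ v → v ∈ p × X (suc v)
    to = λ { (suc v , there v∈ , x) → v , v∈ , x }
    from : (∃ λ v → v ∈ p × X (suc v)) → ∃ λ v → v ∈ outside ∷ p × X v
    from = λ (v , v∈ , x) → suc v , there v∈ , x
  indicator-∃ (inside ∷ p) {X} X? uniq ∃? with X? zero
  ... | yes x = trans (indicator-true ∃? (zero , here , x))
    (cong suc (sym (∑-zero p λ v v∈ →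
      indicator-false (X? (suc v)) (λ y → contradiction (uniq here (there v∈) x y) λ ()))))
  ... | no ¬x = trans (indicator-map′ ∃?)
    (indicator-∃ p (X? ∘ suc) (λ u∈ v∈ x y → suc-injective (uniq (there u∈) (there v∈) x y)) (map′ to from ∃?))
    where
    to : (∃ λ v → v ∈ inside ∷ p × X v) → ∃ λ v → v ∈ p × X (suc v)
    to = λ { (zero , here , x) → contradiction x ¬x ; (suc v , there v∈ , x) → v , v∈ , x }
    from : (∃ λ v → v ∈ p × X (suc v)) → ∃ λ v → v ∈ inside ∷ p × X v
    from = λ (v , v∈ , x) → suc v , there v∈ , x

-- Both products of the formula turn out to have factors of one shape `h`, which lets them fuse into
-- a single product over all blocks.
∏-merge : ∀ {r} (p : Subset r) {f : ∀ i → i ∈ p → ℕ} {g : ∀ i → i ∈ ∁ p → ℕ} {h : Fin r → ℕ} →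
          (∀ i i∈ → f i i∈ ≡ h i) → (∀ i i∈ → g i i∈ ≡ h i) → ∏ p f * ∏ (∁ p) g ≡ ∏ ⊤ (λ i _ → h i)
∏-merge []            f≡ g≡ = refl
∏-merge (inside  ∷ p) {f} f≡ g≡ = trans (*-assoc (f zero here) _ _)
  (cong₂ _*_ (f≡ zero here) (∏-merge p (λ i i∈ → f≡ (suc i) (there i∈)) (λ i i∈ → g≡ (suc i) (there i∈))))
∏-merge (outside ∷ p) {f} {g} f≡ g≡ = trans
  (x∙yz≈y∙xz *-commutativeSemigroup (∏ p _) (g zero here) _)
  (cong₂ _*_ (g≡ zero here) (∏-merge p (λ i i∈ → f≡ (suc i) (there i∈)) (λ i i∈ → g≡ (suc i) (there i∈))))

-- Matchings

-- `P` is meant to be an implication from `IsMatching`, a property that survives the deletion of an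
-- edge.
deletion-induction : ∀ {m ℓ} (P : Pred (Subset m) ℓ) → P ⊥ →
                     (∀ M e → e ∈ M → P (M - e) → P M) → ∀ M → P M
deletion-induction P P⊥ step M = go ∣ M ∣ M refl
  where
  go : ∀ k M → ∣ M ∣ ≡ k → P M
  go k M ∣M∣≡k with nonempty? M
  go k       M ∣M∣≡k | no M-empty rewrite Empty-unique M-empty = P⊥
  go zero    M ∣M∣≡k | yes (e , e∈M) = ⊥-elim (1+n≢0 (trans (∣p-x∣ M e∈M) ∣M∣≡k))
  go (suc k) M ∣M∣≡k | yes (e , e∈M) = step M e e∈M
    (go k (M - e) (cong (_∸ 1) (trans (∣p-x∣ M e∈M) ∣M∣≡k)))

module _ {n m} (F : Graph n m) where

  Joins : Fin m → Fin n → Fin n → Set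
  Joins e x y = ends F e ≡ (x , y) ⊎ ends F e ≡ (y , x)

  Missed : Subset m → Fin n → Set
  Missed M v = ¬ Saturates F M v

module _ {n m} {F : Graph n m} where

  open IsMatching

  mate : ∀ {e x} → Incident F e x → ∃ λ y → Joins F e x y
  mate (inj₁ refl) = _ , inj₁ refl
  mate (inj₂ refl) = _ , inj₂ refl

  joins-sym : ∀ {e x y} → Joins F e x y → Joins F e y x
  joins-sym = [ inj₂ , inj₁ ]′

  joins⇒incidentˡ : ∀ {e x y} → Joins F e x y → Incident F e x
  joins⇒incidentˡ (inj₁ eq) = inj₁ (cong proj₁ eq)
  joins⇒incidentˡ (inj₂ eq) = inj₂ (cong proj₂ eq)

  joins⇒incidentʳ : ∀ {e x y} → Joins F e x y → Incident F e y
  joins⇒incidentʳ = joins⇒incidentˡ ∘ joins-sym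

  incident-joins : ∀ {e x y v} → Joins F e x y → Incident F e v → v ≡ x ⊎ v ≡ y
  incident-joins (inj₁ eq) (inj₁ i) = inj₁ (trans (sym i) (cong proj₁ eq))
  incident-joins (inj₁ eq) (inj₂ i) = inj₂ (trans (sym i) (cong proj₂ eq))
  incident-joins (inj₂ eq) (inj₁ i) = inj₂ (trans (sym i) (cong proj₁ eq))
  incident-joins (inj₂ eq) (inj₂ i) = inj₁ (trans (sym i) (cong proj₂ eq))

  ≢⇒nonLoop : ∀ {e x y} → Joins F e x y → x ≢ y → ¬ Loop F e
  ≢⇒nonLoop (inj₁ eq) x≢y l = x≢y (trans (sym (cong proj₁ eq)) (trans l (cong proj₂ eq)))
  ≢⇒nonLoop (inj₂ eq) x≢y l = x≢y (trans (sym (cong proj₂ eq)) (trans (sym l) (cong proj₁ eq)))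

  incident⇒vertex : ∀ {e x} → e ∈ edges F → Incident F e x → x ∈ vertices F
  incident⇒vertex e∈ (inj₁ refl) = proj₁ (closed F e∈)
  incident⇒vertex e∈ (inj₂ refl) = proj₂ (closed F e∈)

  missed-⊆ : ∀ {M N v} → M ⊆ N → Missed F N v → Missed F M v
  missed-⊆ M⊆N miss (e , e∈M , inc) = miss (e , M⊆N e∈M , inc)

  matching-⊆ : ∀ {M N} → M ⊆ N → IsMatching F N → IsMatching F M
  matching-⊆ M⊆N μ = record
    { areEdges = λ e e∈ → areEdges μ e (M⊆N e∈)
    ; nonLoop  = λ e e∈ → nonLoop μ e (M⊆N e∈)
    ; disjoint = λ e f e∈ f∈ → disjoint μ e f (M⊆N e∈) (M⊆N f∈)
    }

  matching-⊥ : IsMatching F ⊥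
  matching-⊥ = record
    { areEdges = λ e e∈ → ⊥-elim (∉⊥ e∈)
    ; nonLoop  = λ e e∈ → ⊥-elim (∉⊥ e∈)
    ; disjoint = λ e f e∈ → ⊥-elim (∉⊥ e∈)
    }

  delete-missed : ∀ {M e v} → IsMatching F M → e ∈ M → Incident F e v → Missed F (M - e) v
  delete-missed {M} {e} μ e∈M inc (f , f∈ , finc) =
    x∈p-y⇒x≢y M f∈ (disjoint μ f e (x∈p-y⇒x∈p M f∈) e∈M _ finc inc)

  module _ {M e x y} (μ : IsMatching F M) (e∈F : e ∈ edges F) (¬loop : ¬ Loop F e)
           (e-xy : Joins F e x y) (x-missed : Missed F M x) (y-missed : Missed F M y) where

    private
      fresh : ∀ {f v} → f ∈ M → Incident F e v → ¬ Incident F f v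
      fresh f∈M einc finc with incident-joins e-xy einc
      ... | inj₁ refl = x-missed (_ , f∈M , finc)
      ... | inj₂ refl = y-missed (_ , f∈M , finc)

    insert-matching : IsMatching F (M ∪ ⁅ e ⁆)
    insert-matching = record
      { areEdges = λ f f∈ → case f f∈ (areEdges μ f) e∈F
      ; nonLoop  = λ f f∈ → case f f∈ (nonLoop μ f) ¬loop
      ; disjoint = dis
      }
      where
      case : ∀ {P : Fin m → Set} f → f ∈ M ∪ ⁅ e ⁆ → (f ∈ M → P f) → P e → P f
      case f f∈ inM isE with x∈p∪q⁻ M ⁅ e ⁆ f∈
      ... | inj₁ f∈M = inM f∈M
      ... | inj₂ f∈e with x∈⁅y⁆⇒x≡y e f∈e
      ... | refl = isE
      dis : ∀ f g → f ∈ M ∪ ⁅ e ⁆ → g ∈ M ∪ ⁅ e ⁆ → ∀ v → Incident F f v → Incident F g v → f ≡ g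
      dis f g f∈ g∈ v finc ginc with x∈p∪q⁻ M ⁅ e ⁆ f∈ | x∈p∪q⁻ M ⁅ e ⁆ g∈
      ... | inj₁ f∈M | inj₁ g∈M = disjoint μ f g f∈M g∈M v finc ginc
      ... | inj₁ f∈M | inj₂ g∈e rewrite x∈⁅y⁆⇒x≡y e g∈e = ⊥-elim (fresh f∈M ginc finc)
      ... | inj₂ f∈e | inj₁ g∈M rewrite x∈⁅y⁆⇒x≡y e f∈e = ⊥-elim (fresh g∈M finc ginc)
      ... | inj₂ f∈e | inj₂ g∈e = trans (x∈⁅y⁆⇒x≡y e f∈e) (sym (x∈⁅y⁆⇒x≡y e g∈e))

    insert-size : ∣ M ∪ ⁅ e ⁆ ∣ ≡ suc ∣ M ∣
    insert-size = ∣p∪⁅x⁆∣ M (λ e∈M → x-missed (e , e∈M , joins⇒incidentˡ {e = e} e-xy))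

    insert-missed : ∀ {v} → Missed F M v → v ≢ x → v ≢ y → Missed F (M ∪ ⁅ e ⁆) v
    insert-missed miss v≢x v≢y (f , f∈ , finc) with x∈p∪q⁻ M ⁅ e ⁆ f∈
    ... | inj₁ f∈M = miss (f , f∈M , finc)
    ... | inj₂ f∈e rewrite x∈⁅y⁆⇒x≡y e f∈e = [ v≢x , v≢y ]′ (incident-joins e-xy finc)

  saturated : Subset m → Subset n
  saturated M = ⟪ saturates? F M ⟫

  -- Deleting an edge of a matching exposes exactly its two ends, by disjointness, and they differ
  -- because the edge is not a loop.
  ∣saturated∣ : ∀ M → IsMatching F M → ∣ saturated M ∣ ≡ 2 * ∣ M ∣
  ∣saturated∣ = deletion-induction _ base step
    where
    open ≡-Reasoning
    base : IsMatching F ⊥ → ∣ saturated ⊥ ∣ ≡ 2 * ∣ ⊥ {m} ∣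
    base _ = begin
      ∣ saturated ⊥ ∣ ≡⟨ cong ∣_∣ (Empty-unique λ (v , v∈) →
                           let e , e∈ , _ = ∈⟪⟫⁻ (saturates? F ⊥) v∈ in ∉⊥ e∈) ⟩
      ∣ ⊥ {n} ∣       ≡⟨ ∣⊥∣≡0 n ⟩
      2 * 0           ≡⟨ cong (2 *_) (∣⊥∣≡0 m) ⟨
      2 * ∣ ⊥ {m} ∣   ∎
    step : ∀ M e → e ∈ M → (IsMatching F (M - e) → ∣ saturated (M - e) ∣ ≡ 2 * ∣ M - e ∣) →
           IsMatching F M → ∣ saturated M ∣ ≡ 2 * ∣ M ∣
    step M e e∈M ih μ = begin
      ∣ saturated M ∣                          ≡⟨ cong ∣_∣ (⊆-antisym fwd bwd) ⟩
      ∣ (saturated (M - e) ∪ ⁅ s ⁆) ∪ ⁅ t ⁆ ∣  ≡⟨ ∣p∪⁅x⁆∣ (saturated (M - e) ∪ ⁅ s ⁆) t∉ ⟩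
      suc ∣ saturated (M - e) ∪ ⁅ s ⁆ ∣        ≡⟨ cong suc (∣p∪⁅x⁆∣ (saturated (M - e)) s∉) ⟩
      2 + ∣ saturated (M - e) ∣                ≡⟨ cong (2 +_) (ih (matching-⊆ (x∈p-y⇒x∈p M) μ)) ⟩
      2 + 2 * ∣ M - e ∣                        ≡⟨ *-suc 2 ∣ M - e ∣ ⟨
      2 * suc ∣ M - e ∣                        ≡⟨ cong (2 *_) (∣p-x∣ M e∈M) ⟩
      2 * ∣ M ∣                                ∎
      where
      s = proj₁ (ends F e)
      t = proj₂ (ends F e)
      s∉ : s ∉ saturated (M - e)
      s∉ s∈ = delete-missed μ e∈M (inj₁ refl) (∈⟪⟫⁻ (saturates? F (M - e)) s∈)
      t∉ : t ∉ saturated (M - e) ∪ ⁅ s ⁆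
      t∉ t∈ = [ (λ t∈ → delete-missed μ e∈M (inj₂ refl) (∈⟪⟫⁻ (saturates? F (M - e)) t∈))
              , (λ t∈s → nonLoop μ e e∈M (sym (x∈⁅y⁆⇒x≡y s t∈s))) ]′ (x∈p∪q⁻ _ _ t∈)
      fwd : saturated M ⊆ (saturated (M - e) ∪ ⁅ s ⁆) ∪ ⁅ t ⁆
      fwd v∈ with ∈⟪⟫⁻ (saturates? F M) v∈
      ... | f , f∈M , finc with f ≟ e
      ... | no f≢e = x∈p∪q⁺ (inj₁ (x∈p∪q⁺ (inj₁ (∈⟪⟫⁺ (saturates? F (M - e))
                       (f , x∈p∧x≢y⇒x∈p-y f∈M f≢e , finc)))))
      fwd v∈ | _ , _ , inj₁ refl | yes refl = x∈p∪q⁺ (inj₁ (x∈p∪q⁺ (inj₂ (x∈⁅x⁆ s))))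
      fwd v∈ | _ , _ , inj₂ refl | yes refl = x∈p∪q⁺ (inj₂ (x∈⁅x⁆ t))
      bwd : (saturated (M - e) ∪ ⁅ s ⁆) ∪ ⁅ t ⁆ ⊆ saturated M
      bwd v∈ with x∈p∪q⁻ _ _ v∈
      ... | inj₂ v∈t = ∈⟪⟫⁺ (saturates? F M) (e , e∈M , inj₂ (sym (x∈⁅y⁆⇒x≡y t v∈t)))
      ... | inj₁ v∈′ with x∈p∪q⁻ _ _ v∈′
      ... | inj₂ v∈s = ∈⟪⟫⁺ (saturates? F M) (e , e∈M , inj₁ (sym (x∈⁅y⁆⇒x≡y s v∈s)))
      ... | inj₁ v∈″ with ∈⟪⟫⁻ (saturates? F (M - e)) v∈″
      ... | f , f∈ , finc = ∈⟪⟫⁺ (saturates? F M) (f , x∈p-y⇒x∈p M f∈ , finc)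

  perfect-size : ∀ {M} → IsPerfectMatching F M → 2 * ∣ M ∣ ≡ ∣ vertices F ∣
  perfect-size {M} (μ , sat) = trans (sym (∣saturated∣ M μ)) (cong ∣_∣ (⊆-antisym
    (λ v∈ → let e , e∈ , inc = ∈⟪⟫⁻ (saturates? F M) v∈ in incident⇒vertex (areEdges μ e e∈) inc)
    (λ v∈ → ∈⟪⟫⁺ (saturates? F M) (sat _ v∈))))

  -- In other words, `S` is a vertex cover of the edges in `M`.
  Hits : Subset n → Subset m → Set
  Hits S M = ∀ e → e ∈ M → ∃ λ v → v ∈ S × Incident F e v

  hits-delete : ∀ {M e v S} → IsMatching F M → e ∈ M → Incident F e v → Hits S M → Hits (S - v) (M - e)
  hits-delete {M} μ e∈M inc hits f f∈ with hits f (x∈p-y⇒x∈p M f∈)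
  ... | u , u∈S , finc = u , x∈p∧x≢y⇒x∈p-y u∈S
    (λ { refl → delete-missed μ e∈M inc (f , f∈ , finc) }) , finc

  -- Weak duality between matchings and covers: edges of a matching share no vertex, so each one
  -- uses up a covering vertex of its own.
  hits⇒∣M∣≤∣S∣ : ∀ M → IsMatching F M → ∀ S → Hits S M → ∣ M ∣ ≤ ∣ S ∣
  hits⇒∣M∣≤∣S∣ = deletion-induction _
    (λ _ _ _ → subst (_≤ _) (sym (∣⊥∣≡0 m)) z≤n)
    λ M e e∈M ih μ S hits → let v , v∈S , inc = hits e e∈M in
      subst₂ _≤_ (∣p-x∣ M e∈M) (∣p-x∣ S v∈S)
        (s≤s (ih (matching-⊆ (x∈p-y⇒x∈p M) μ) (S - v) (hits-delete μ e∈M inc hits)))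

  -- An edge with both ends in the cover uses up two covering vertices. After its removal the rest
  -- is still covered by `S` without these two.
  hits⇒∣M∣<∣S∣ : ∀ {M S e} → IsMatching F M → Hits S M → e ∈ M → Within F S e → ∣ M ∣ < ∣ S ∣
  hits⇒∣M∣<∣S∣ {M} {S} {e} μ hits e∈M (s∈S , t∈S) = subst₂ _<_ (∣p-x∣ M e∈M) ∣S∣≡
    (s≤s (s≤s (hits⇒∣M∣≤∣S∣ (M - e) (matching-⊆ (x∈p-y⇒x∈p M) μ) (S - s - t) hits′)))
    where
    s = proj₁ (ends F e)
    t = proj₂ (ends F e)
    ∣S∣≡ : 2 + ∣ S - s - t ∣ ≡ ∣ S ∣
    ∣S∣≡ = trans (cong suc (∣p-x∣ (S - s) (x∈p∧x≢y⇒x∈p-y t∈S (λ t≡s → nonLoop μ e e∈M (sym t≡s))))) (∣p-x∣ S s∈S)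
    hits′ : Hits (S - s - t) (M - e)
    hits′ f f∈ with hits f (x∈p-y⇒x∈p M f∈)
    ... | u , u∈S , finc = u , x∈p∧x≢y⇒x∈p-y (x∈p∧x≢y⇒x∈p-y u∈S
            (λ { refl → delete-missed μ e∈M (inj₁ refl) (f , f∈ , finc) }))
            (λ { refl → delete-missed μ e∈M (inj₂ refl) (f , f∈ , finc) }) , finc

  maximum-exists : ∃ (IsMaximumMatching F)
  -- The first argument bounds the number of further enlargements; `m` suffices at the start because
  -- no edge set has more than `m` elements.
  maximum-exists = go m ⊥ matching-⊥ (m≤n+m m ∣ ⊥ {m} ∣)
    where
    go : ∀ k M → IsMatching F M → m ≤ ∣ M ∣ + k → ∃ (IsMaximumMatching F)
    go k M μ m≤ with anySubset? (λ M′ → isMatching? F M′ ×-dec ¬? (∣ M′ ∣ ≤? ∣ M ∣))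
    ... | no none = M , μ , λ M′ μ′ → decidable-stable (∣ M′ ∣ ≤? ∣ M ∣) (λ ≰ → none (M′ , μ′ , ≰))
    go zero    M μ m≤ | yes (M′ , μ′ , ≰) = ⊥-elim (≰ (≤-trans (∣p∣≤n M′) (subst (m ≤_) (+-identityʳ _) m≤)))
    go (suc k) M μ m≤ | yes (M′ , μ′ , ≰) =
      go k M′ μ′ (≤-trans m≤ (subst (_≤ ∣ M′ ∣ + k) (sym (+-suc ∣ M ∣ k)) (+-monoˡ-≤ k (≰⇒> ≰))))

  maximum-size : ∀ {M N} → IsMaximumMatching F M → IsMaximumMatching F N → ∣ M ∣ ≡ ∣ N ∣
  maximum-size (μ , max) (ν , max′) = ≤-antisym (max′ _ μ) (max _ ν)

-- Exchanging edges between two matchings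

module _ {n m} {F : Graph n m} where

  open IsMatching

  -- Only the size `s` of the matching to be improved is recorded, since the matching itself changes
  -- during the exchange. In the second outcome `y` need not lie in `X`; if it does not, all of `X`
  -- stays missed.
  Improvement : Subset n → Subset n → ℕ → Set
  Improvement X W s =
      (∃ λ L′ → IsMatching F L′ × ∣ L′ ∣ ≡ s × (∀ {x} → x ∈ X → Missed F L′ x)
              × ∃ λ w → w ∈ W × Missed F L′ w)
    ⊎ (∃ λ L′ → ∃ λ y → IsMatching F L′ × ∣ L′ ∣ ≡ suc s
              × (∀ {x} → x ∈ X → x ≢ y → Missed F L′ x))

  -- If both alternatives failed, the disjoint union of `W` and the vertices saturated by `N` would
  -- lie in that of `X` and the vertices saturated by `L`. Counting both sides contradicts the
  -- assumed inequality.
  exposed-vertex : ∀ {L N} X W → IsMatching F L → IsMatching F N →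
                   (∀ {x} → x ∈ X → Missed F L x) → (∀ {w} → w ∈ W → Missed F N w) →
                   ∣ X ∣ + 2 * ∣ L ∣ < 2 * ∣ N ∣ + ∣ W ∣ →
                   (∃ λ w → w ∈ W × Missed F L w) ⊎ (∃ λ x → Saturates F N x × Missed F L x × x ∉ X)
  exposed-vertex {L} {N} X W μ ν X-missed W-missed small
    with any? (λ w → (w ∈? W) ×-dec ¬? (saturates? F L w))
       | any? (λ x → saturates? F N x ×-dec ¬? (saturates? F L x) ×-dec ¬? (x ∈? X))
  ... | yes w | _     = inj₁ w
  ... | no _  | yes x = inj₂ x
  ... | no ¬w | no ¬x = ⊥-elim (<⇒≱ small (begin
    2 * ∣ N ∣ + ∣ W ∣          ≡⟨ cong (_+ ∣ W ∣) (∣saturated∣ N ν) ⟨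
    ∣ saturated {F = F} N ∣ + ∣ W ∣    ≡⟨ disjoint⇒∣p∪q∣ _ W (λ v∈ w∈ → W-missed w∈ (∈⟪⟫⁻ (saturates? F N) v∈)) ⟨
    ∣ saturated {F = F} N ∪ W ∣        ≤⟨ p⊆q⇒∣p∣≤∣q∣ (λ v∈ → covered (x∈p∪q⁻ _ W v∈)) ⟩
    ∣ X ∪ saturated {F = F} L ∣        ≡⟨ disjoint⇒∣p∪q∣ X _ (λ x∈ v∈ → X-missed x∈ (∈⟪⟫⁻ (saturates? F L) v∈)) ⟩
    ∣ X ∣ + ∣ saturated {F = F} L ∣    ≡⟨ cong (∣ X ∣ +_) (∣saturated∣ L μ) ⟩
    ∣ X ∣ + 2 * ∣ L ∣          ∎))
    where
    open ≤-Reasoning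
    covered : ∀ {v} → v ∈ saturated {F = F} N ⊎ v ∈ W → v ∈ X ∪ saturated {F = F} L
    covered {v} v∈ with saturates? F L v | v ∈? X
    ... | yes sat | _       = x∈p∪q⁺ (inj₂ (∈⟪⟫⁺ (saturates? F L) sat))
    ... | no _    | yes v∈X = x∈p∪q⁺ (inj₁ v∈X)
    covered (inj₁ v∈N) | no miss | no v∉X = ⊥-elim (¬x (_ , ∈⟪⟫⁻ (saturates? F N) v∈N , miss , v∉X))
    covered (inj₂ v∈W) | no miss | no _   = ⊥-elim (¬w (_ , v∈W , miss))

  exchange : ∀ {L N} X W → IsMatching F L → IsMatching F N →
             (∀ {x} → x ∈ X → Missed F L x) → (∀ {w} → w ∈ W → Missed F N w) →
             ∣ X ∣ + 2 * ∣ L ∣ < 2 * ∣ N ∣ + ∣ W ∣ → Improvement X W ∣ L ∣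
  exchange {N = N} X W μ₀ ν X-missed₀ W-missed = go _ μ₀ X-missed₀ ≤-refl
    where
    go : ∀ k {L} → IsMatching F L → (∀ {x} → x ∈ X → Missed F L x) → ∣ N ─ L ∣ < k →
         ∣ X ∣ + 2 * ∣ L ∣ < 2 * ∣ N ∣ + ∣ W ∣ → Improvement X W ∣ L ∣
    go (suc k) {L} μ X-missed (s≤s bound) small with exposed-vertex X W μ ν X-missed W-missed small
    ... | inj₁ w∈ = inj₁ (L , μ , refl , X-missed , w∈)
    ... | inj₂ (x , (e , e∈N , e-x) , x-missed , x∉X) with mate {F = F} e-x
    ... | y , e-xy with saturates? F L y
    -- Both ends of `e` are free in `L`, so `e` is simply added; `y` is the only vertex of `X` that
    -- this can saturate.
    ... | no y-missed = inj₂ (_ , y , insert-matching μ e∈F ¬loop e-xy x-missed y-missed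
                                , insert-size μ e∈F ¬loop e-xy x-missed y-missed
                                , λ x′∈ x′≢y → insert-missed μ e∈F ¬loop e-xy x-missed y-missed (X-missed x′∈)
                                    (λ { refl → x∉X x′∈ }) x′≢y)
      where
      e∈F = areEdges ν e e∈N
      ¬loop = nonLoop ν e e∈N
    -- Trading `f` for `e` keeps the size and frees the other end of `f`. All of `X` stays missed,
    -- since `x` lies outside `X` and `y` was already saturated by `L`.
    ... | yes (f , f∈L , f-y) = subst (Improvement X W) size (go k μ′ X-missed′ (<-≤-trans (p⊂q⇒∣p∣<∣q∣ closer) bound)
                                              (subst (λ s → ∣ X ∣ + 2 * s < _) (sym size) small))
      where
      e∈F = areEdges ν e e∈N
      ¬loop = nonLoop ν e e∈N
      e-y : Incident F e y
      e-y = joins⇒incidentʳ {F = F} {e = e} e-xy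
      e∉L : e ∉ L
      e∉L e∈L = x-missed (e , e∈L , e-x)
      μ⁻ = matching-⊆ (x∈p-y⇒x∈p L) μ
      x-missed⁻ = missed-⊆ {F = F} (x∈p-y⇒x∈p L) x-missed
      y-missed⁻ = delete-missed μ f∈L f-y
      L′ = (L - f) ∪ ⁅ e ⁆
      μ′ : IsMatching F L′
      μ′ = insert-matching μ⁻ e∈F ¬loop e-xy x-missed⁻ y-missed⁻
      size : ∣ L′ ∣ ≡ ∣ L ∣
      size = trans (insert-size μ⁻ e∈F ¬loop e-xy x-missed⁻ y-missed⁻) (∣p-x∣ L f∈L)
      X-missed′ : ∀ {x} → x ∈ X → Missed F L′ x
      X-missed′ x′∈ = insert-missed μ⁻ e∈F ¬loop e-xy x-missed⁻ y-missed⁻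
        (missed-⊆ {F = F} (x∈p-y⇒x∈p L) (X-missed x′∈))
        (λ { refl → x∉X x′∈ }) (λ { refl → X-missed x′∈ (f , f∈L , f-y) })
      -- The distance to `N` drops: `e` is gained, and the lost edge `f` is not in `N`, as it meets
      -- `e` in `y` and would otherwise equal `e`, which is not in `L`.
      closer : N ─ L′ ⊂ N ─ L
      closer = (λ {g} g∈ → x∈p∧x∉q⇒x∈p─q (p─q⊆p N L′ g∈) (λ g∈L → g∉L g∈ g∈L))
             , e , x∈p∧x∉q⇒x∈p─q e∈N e∉L , λ e∈ → x∈p─q⇒x∉q N L′ e∈ (x∈p∪q⁺ (inj₂ (x∈⁅x⁆ e)))
        where
        g∉L : ∀ {g} → g ∈ N ─ L′ → g ∉ L
        g∉L {g} g∈ g∈L with g ≟ f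
        ... | no g≢f   = x∈p─q⇒x∉q N L′ g∈ (x∈p∪q⁺ (inj₁ (x∈p∧x≢y⇒x∈p-y g∈L g≢f)))
        ... | yes refl = e∉L (subst (_∈ L) (disjoint ν g e (p─q⊆p N L′ g∈) e∈N y f-y e-y) g∈L)

  Inessential : Fin n → Set
  Inessential v = ∃ λ M → IsMaximumMatching F M × Missed F M v

  -- Gallai's relation on the vertices; it is an equivalence on the inessential ones.
  NeverBothMissed : Fin n → Fin n → Set
  NeverBothMissed u v = ∀ M → IsMaximumMatching F M → Missed F M u → Missed F M v → u ≡ v

  -- An edge between two distinct missed vertices could be added to a maximum matching.
  adjacent⇒neverBothMissed : ∀ {u v} → Adjacent F u v → NeverBothMissed u v
  adjacent⇒neverBothMissed {u} {v} (e , e∈F , e-uv) M (μ , max) u-missed v-missed with u ≟ v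
  ... | yes u≡v = u≡v
  ... | no u≢v = ⊥-elim (<⇒≱ (≤-reflexive (sym (insert-size μ e∈F ¬loop e-uv u-missed v-missed)))
                             (max _ (insert-matching μ e∈F ¬loop e-uv u-missed v-missed)))
    where
    ¬loop : ¬ Loop F e
    ¬loop = ≢⇒nonLoop {F = F} {e = e} e-uv u≢v

  -- Suppose `M` misses distinct `u` and `v`, and exchange a maximum matching missing `t` against
  -- `M`, with `X` the vertex `t` and `W` the pair `u`, `v`. No larger matching exists, so a maximum
  -- matching appears that misses `t` together with `u` or `v`.
  neverBothMissed-trans : ∀ {u t v} → Inessential t → NeverBothMissed u t → NeverBothMissed t v →
                          NeverBothMissed u v
  neverBothMissed-trans {u} {t} {v} (N , (ν , N-max) , t-missed) ut tv M (μ , M-max) u-missed v-missed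
    with u ≟ v
  ... | yes u≡v = u≡v
  ... | no u≢v with exchange ⁅ t ⁆ (⁅ u ⁆ ∪ ⁅ v ⁆) ν μ
         (λ x∈ → subst (Missed F N) (sym (x∈⁅y⁆⇒x≡y t x∈)) t-missed)
         (λ w∈ → [ (λ w∈u → subst (Missed F M) (sym (x∈⁅y⁆⇒x≡y u w∈u)) u-missed)
                 , (λ w∈v → subst (Missed F M) (sym (x∈⁅y⁆⇒x≡y v w∈v)) v-missed) ]′ (x∈p∪q⁻ _ _ w∈))
         small
    where
    small : ∣ ⁅ t ⁆ ∣ + 2 * ∣ N ∣ < 2 * ∣ M ∣ + ∣ ⁅ u ⁆ ∪ ⁅ v ⁆ ∣
    small = begin-strict
      ∣ ⁅ t ⁆ ∣ + 2 * ∣ N ∣            ≡⟨ cong (_+ 2 * ∣ N ∣) (∣⁅x⁆∣≡1 t) ⟩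
      1 + 2 * ∣ N ∣                    <⟨ ≤-refl ⟩
      2 + 2 * ∣ N ∣                    ≡⟨ +-comm 2 (2 * ∣ N ∣) ⟩
      2 * ∣ N ∣ + 2                    ≡⟨ cong₂ (λ a b → 2 * a + suc b)
                                          (maximum-size (ν , N-max) (μ , M-max)) (sym (∣⁅x⁆∣≡1 u)) ⟩
      2 * ∣ M ∣ + suc ∣ ⁅ u ⁆ ∣        ≡⟨ cong (2 * ∣ M ∣ +_) (∣p∪⁅x⁆∣ ⁅ u ⁆ (λ v∈ → u≢v (sym (x∈⁅y⁆⇒x≡y u v∈)))) ⟨
      2 * ∣ M ∣ + ∣ ⁅ u ⁆ ∪ ⁅ v ⁆ ∣    ∎
      where open ≤-Reasoning
  ... | inj₂ (L , _ , λ′ , size , _) = ⊥-elim (<⇒≱ (≤-reflexive (sym size)) (N-max L λ′))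
  ... | inj₁ (L , λ′ , size , t-missed′ , w , w∈ , w-missed) = viaOne (x∈p∪q⁻ _ _ w∈)
    where
    L-max : IsMaximumMatching F L
    L-max = λ′ , λ M′ μ′ → subst (∣ M′ ∣ ≤_) (sym size) (N-max M′ μ′)
    -- Missing `w` and `t` together identifies `t` with `u` or `v`; the other hypothesis then
    -- applies to `M` itself.
    viaOne : w ∈ ⁅ u ⁆ ⊎ w ∈ ⁅ v ⁆ → u ≡ v
    viaOne (inj₁ w∈u) with x∈⁅y⁆⇒x≡y u w∈u
    ... | refl with ut L L-max w-missed (t-missed′ (x∈⁅x⁆ t))
    ... | refl = tv M (μ , M-max) u-missed v-missed
    viaOne (inj₂ w∈v) with x∈⁅y⁆⇒x≡y v w∈v
    ... | refl with tv L L-max (t-missed′ (x∈⁅x⁆ t)) w-missed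
    ... | refl = ut M (μ , M-max) u-missed v-missed

-- The Gallai–Edmonds structure theorem

module _ {n m} {G : Graph n m} {S : Subset n} where

  open IsMatching

  private
    inner? : Decidable (λ e → e ∈ edges G × Within G S e)
    inner? e = (e ∈? edges G) ×-dec within? G S e

  induced-edge⁺ : ∀ {e} → e ∈ edges G → Within G S e → e ∈ edges (G [ S ])
  induced-edge⁺ e∈G e⊆S = ∈⟪⟫⁺ inner? (e∈G , e⊆S)

  induced-edge⁻ : ∀ {e} → e ∈ edges (G [ S ]) → e ∈ edges G × Within G S e
  induced-edge⁻ = ∈⟪⟫⁻ inner?

  induced-matching⁺ : ∀ {M} → IsMatching G M → M ⊆ edges (G [ S ]) → IsMatching (G [ S ]) M
  induced-matching⁺ μ M⊆ = record
    { areEdges = λ _ → M⊆ ; nonLoop = nonLoop μ ; disjoint = disjoint μ }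

  induced-matching⁻ : ∀ {M} → IsMatching (G [ S ]) M → IsMatching G M
  induced-matching⁻ μ = record
    { areEdges = λ e e∈ → proj₁ (induced-edge⁻ (areEdges μ e e∈)) ; nonLoop = nonLoop μ ; disjoint = disjoint μ }

within-incident : ∀ {n m} {G : Graph n m} {S e v} → Within G S e → Incident G e v → v ∈ S
within-incident (s∈ , t∈) (inj₁ refl) = s∈
within-incident (s∈ , t∈) (inj₂ refl) = t∈

-- The three sets enter only through introduction and elimination rules, so that later arguments
-- never unfold the decision procedures from which `D`, `A` and `C` are tabulated.
record GallaiEdmonds {n m} (G : Graph n m) (Dᴳ Aᴳ Cᴳ : Subset n) : Set where
  field
    ∈D⁺ : ∀ {v} → v ∈ vertices G → Inessential {F = G} v → v ∈ Dᴳ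
    ∈D⁻ : ∀ {v} → v ∈ Dᴳ → v ∈ vertices G × Inessential {F = G} v
    ∈A⁺ : ∀ {v u} → v ∈ vertices G → v ∉ Dᴳ → u ∈ Dᴳ → Adjacent G v u → v ∈ Aᴳ
    ∈A⁻ : ∀ {v} → v ∈ Aᴳ → v ∈ vertices G × v ∉ Dᴳ × ∃ λ u → u ∈ Dᴳ × Adjacent G v u
    ∈C⁺ : ∀ {v} → v ∈ vertices G → v ∉ Dᴳ → v ∉ Aᴳ → v ∈ Cᴳ
    ∈C⁻ : ∀ {v} → v ∈ Cᴳ → v ∈ vertices G × v ∉ Dᴳ × v ∉ Aᴳ

gallaiEdmonds : ∀ {n m} (G : Graph n m) → GallaiEdmonds G (D G) (A G) (C G)
gallaiEdmonds G = record
  { ∈D⁺ = λ v∈V v-in → ∈⟪⟫⁺ D? (v∈V , v-in)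
  ; ∈D⁻ = ∈⟪⟫⁻ D?
  ; ∈A⁺ = λ v∈V v∉D u∈D vu → ∈⟪⟫⁺ A? (x∈p∧x∉q⇒x∈p─q v∈V v∉D , _ , u∈D , vu)
  ; ∈A⁻ = λ v∈A → let v∈ , u = ∈⟪⟫⁻ A? v∈A in p─q⊆p V (D G) v∈ , x∈p─q⇒x∉q V (D G) v∈ , u
  ; ∈C⁺ = λ v∈V v∉D v∉A → x∈p∧x∉q⇒x∈p─q v∈V λ v∈ → [ v∉D , v∉A ]′ (x∈p∪q⁻ (D G) (A G) v∈)
  ; ∈C⁻ = λ v∈C → let v∉ = x∈p─q⇒x∉q V (D G ∪ A G) v∈C in
      p─q⊆p V _ v∈C , (λ v∈D → v∉ (x∈p∪q⁺ (inj₁ v∈D))) , (λ v∈A → v∉ (x∈p∪q⁺ (inj₂ v∈A)))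
  }
  where
  V = vertices G

  D? : Decidable (λ v → v ∈ V × ∃ λ M → IsMaximumMatching G M × ¬ Saturates G M v)
  D? v = (v ∈? V) ×-dec anySubset? (λ M → isMaximumMatching? G M ×-dec ¬? (saturates? G M v))

  A? : Decidable (λ v → v ∈ V ─ D G × ∃ λ u → u ∈ D G × Adjacent G v u)
  A? v = (v ∈? V ─ D G) ×-dec any? (λ u → (u ∈? D G) ×-dec adjacent? G v u)

module Structure {n m} {G : Graph n m} {Dᴳ Aᴳ Cᴳ : Subset n} (ge : GallaiEdmonds G Dᴳ Aᴳ Cᴳ) where

  open IsMatching
  open GallaiEdmonds ge

  private
    V = vertices G

  A∌D : ∀ {v} → v ∈ Aᴳ → v ∉ Dᴳ
  A∌D v∈A = proj₁ (proj₂ (∈A⁻ v∈A))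

  C∌D : ∀ {v} → v ∈ Cᴳ → v ∉ Dᴳ
  C∌D v∈C = proj₁ (proj₂ (∈C⁻ v∈C))

  C∌A : ∀ {v} → v ∈ Cᴳ → v ∉ Aᴳ
  C∌A v∈C = proj₂ (proj₂ (∈C⁻ v∈C))

  partition : ∀ {v} → v ∈ V → v ∈ Cᴳ ⊎ v ∈ Aᴳ ⊎ v ∈ Dᴳ
  partition {v} v∈V with v ∈? Aᴳ | v ∈? Dᴳ
  ... | yes v∈A | _       = inj₂ (inj₁ v∈A)
  ... | no _    | yes v∈D = inj₂ (inj₂ v∈D)
  ... | no v∉A  | no v∉D  = inj₁ (∈C⁺ v∈V v∉D v∉A)

  -- Induction on `s`. For `s` zero, failure would make `L` a maximum matching missing `u`, putting
  -- `u` into `Dᴳ`. Otherwise some `a` in `T` has a neighbour `v` in `Dᴳ`, and `L` is exchanged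
  -- against a maximum matching missing `v`. Every outcome yields a matching with one edge more than
  -- `L` that gives up only one of the vertices of `T` and `u`.
  deficit : ∀ s T u {L M} → ∣ T ∣ ≡ s → T ⊆ Aᴳ → u ∈ V → u ∉ Dᴳ → u ∉ T →
            IsMatching G L → (∀ {x} → x ∈ T → Missed G L x) → Missed G L u →
            IsMaximumMatching G M → ∣ L ∣ + s < ∣ M ∣
  deficit zero T u {L} {M} _ _ u∈V u∉D _ λ′ _ u-missed (μ , max)
    rewrite +-identityʳ ∣ L ∣ with ∣ M ∣ ≤? ∣ L ∣
  ... | no nle  = ≰⇒> nle
  ... | yes le = ⊥-elim (u∉D (∈D⁺ u∈V (L , (λ′ , λ M′ μ′ → ≤-trans (max M′ μ′) le) , u-missed)))
  deficit (suc s) T u {L} {M} ∣T∣ T⊆A u∈V u∉D u∉T λ′ T-missed u-missed M-max@(_ , max)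
    with ∣ M ∣ ≤? ∣ L ∣ + suc s | nonempty? T
  ... | no nle | _ = ≰⇒> nle
  ... | yes _ | no T-empty = ⊥-elim (0≢1+n (trans (sym (trans (cong ∣_∣ (Empty-unique T-empty)) (∣⊥∣≡0 n))) ∣T∣))
  ... | yes le | yes (a , a∈T) = ⊥-elim (refute (∈A⁻ (T⊆A a∈T)))
    where
    smaller : ∀ {x} → x ∈ T → ∣ T - x ∣ ≡ s
    smaller x∈T = cong (_∸ 1) (trans (∣p-x∣ T x∈T) ∣T∣)

    recurse : ∀ {L′ x v} → x ∈ T → v ∈ V → v ∉ Dᴳ → v ∉ T - x → IsMatching G L′ →
              (∀ {z} → z ∈ T - x → Missed G L′ z) → Missed G L′ v → ∣ L′ ∣ + s < ∣ M ∣
    recurse x∈T v∈V v∉D v∉ μ′ missed v-missed =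
      deficit s (T - _) _ (smaller x∈T) (T⊆A ∘ x∈p-y⇒x∈p T) v∈V v∉D v∉ μ′ missed v-missed M-max

    -- This branch assumes that the claim fails for `L`; a matching with one more edge then cannot
    -- satisfy the claim for `s`.
    tooLarge : ∀ (L′ : Subset m) → ∣ L′ ∣ ≡ suc ∣ L ∣ → ¬ ∣ L′ ∣ + s < ∣ M ∣
    tooLarge L′ size lt = <⇒≱ lt (≤-trans le (≤-reflexive (trans (+-suc ∣ L ∣ s) (cong (_+ s) (sym size)))))

    drop : ∀ {z x} → z ∈ T - x → z ∈ T
    drop = x∈p-y⇒x∈p T

    refute : ¬ (a ∈ V × a ∉ Dᴳ × ∃ λ v → v ∈ Dᴳ × Adjacent G a v)
    refute (a∈V , a∉D , v , v∈D , e , e∈G , e-av) with ∈D⁻ v∈D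
    ... | v∈V , N , N-max@(ν , _) , v-missed with exchange (T ∪ ⁅ u ⁆) ⁅ v ⁆ λ′ ν
          (λ x∈ → [ T-missed , (λ x∈u → subst (Missed G L) (sym (x∈⁅y⁆⇒x≡y u x∈u)) u-missed) ]′ (x∈p∪q⁻ T ⁅ u ⁆ x∈))
          (λ w∈ → subst (Missed G N) (sym (x∈⁅y⁆⇒x≡y v w∈)) v-missed)
          small
      where
      small : ∣ T ∪ ⁅ u ⁆ ∣ + 2 * ∣ L ∣ < 2 * ∣ N ∣ + ∣ ⁅ v ⁆ ∣
      small = begin-strict
        ∣ T ∪ ⁅ u ⁆ ∣ + 2 * ∣ L ∣         ≡⟨ cong (_+ 2 * ∣ L ∣) (trans (∣p∪⁅x⁆∣ T u∉T) (cong suc ∣T∣)) ⟩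
        suc (suc s) + 2 * ∣ L ∣           <⟨ arith ⟩
        -- The induction hypothesis for `L` itself, with `a` dropped from `T`, already shows `L` to
        -- be small enough for the exchange.
        2 * suc (∣ L ∣ + s) + 1           ≤⟨ +-monoˡ-≤ 1 (*-monoʳ-≤ 2
                                               (recurse a∈T u∈V u∉D (u∉T ∘ drop) λ′ (T-missed ∘ drop) u-missed)) ⟩
        2 * ∣ M ∣ + 1                     ≡⟨ cong₂ (λ x y → 2 * x + y) (maximum-size M-max N-max) (sym (∣⁅x⁆∣≡1 v)) ⟩
        2 * ∣ N ∣ + ∣ ⁅ v ⁆ ∣             ∎
        where
        open ≤-Reasoning
        lemma : ∀ l s → 2 * suc (l + s) + 1 ≡ suc (suc (suc s) + 2 * l) + s
        lemma = solve-∀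
        arith : suc (suc s) + 2 * ∣ L ∣ < 2 * suc (∣ L ∣ + s) + 1
        arith = ≤-trans (m≤m+n _ s) (≤-reflexive (sym (lemma ∣ L ∣ s)))
    -- Now `a` and `v` are both free, so the edge joining them is added and `a` leaves `T`.
    ... | inj₁ (L′ , μ′ , size , X-missed , w , w∈ , w-missed) =
      tooLarge (L′ ∪ ⁅ e ⁆) (trans (insert-size μ′ e∈G ¬loop e-av a-missed v-missed′) (cong suc size))
        (recurse a∈T u∈V u∉D (u∉T ∘ drop) (insert-matching μ′ e∈G ¬loop e-av a-missed v-missed′)
          (λ z∈ → insert-missed μ′ e∈G ¬loop e-av a-missed v-missed′ (X-missed (x∈p∪q⁺ (inj₁ (drop z∈))))
             (x∈p-y⇒x≢y T z∈) λ { refl → A∌D (T⊆A (drop z∈)) v∈D })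
          (insert-missed μ′ e∈G ¬loop e-av a-missed v-missed′ (X-missed (x∈p∪q⁺ (inj₂ (x∈⁅x⁆ u))))
             (λ { refl → u∉T a∈T }) (λ { refl → u∉D v∈D })))
      where
      ¬loop : ¬ Loop G e
      ¬loop = ≢⇒nonLoop {F = G} {e = e} e-av λ { refl → a∉D v∈D }
      a-missed = X-missed (x∈p∪q⁺ (inj₁ a∈T))
      v-missed′ = subst (Missed G L′) (x∈⁅y⁆⇒x≡y v w∈) w-missed
    ... | inj₂ (L′ , y , μ′ , size , X-missed) with y ≟ u | y ∈? T
    -- The vertex given up is `u`. All of `T` is still missed, so `a` leaves `T` and takes over the
    -- role of `u`.
    ... | yes refl | _ = tooLarge L′ size (recurse a∈T a∈V a∉D (λ a∈ → x∈p-y⇒x≢y T a∈ refl) μ′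
            (λ z∈ → X-missed (x∈p∪q⁺ (inj₁ (drop z∈))) λ { refl → u∉T (drop z∈) })
            (X-missed (x∈p∪q⁺ (inj₁ a∈T)) λ { refl → u∉T a∈T }))
    ... | no y≢u | yes y∈T = tooLarge L′ size (recurse y∈T u∈V u∉D (u∉T ∘ drop) μ′
            (λ z∈ → X-missed (x∈p∪q⁺ (inj₁ (drop z∈))) (x∈p-y⇒x≢y T z∈))
            (X-missed (x∈p∪q⁺ (inj₂ (x∈⁅x⁆ u))) (y≢u ∘ sym)))
    -- No vertex of `T` and not `u` was given up, so any vertex of `T` may be dropped; `a` is at
    -- hand.
    ... | no y≢u | no y∉T = tooLarge L′ size (recurse a∈T u∈V u∉D (u∉T ∘ drop) μ′
            (λ z∈ → X-missed (x∈p∪q⁺ (inj₁ (drop z∈))) λ { refl → y∉T (drop z∈) })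
            (X-missed (x∈p∪q⁺ (inj₂ (x∈⁅x⁆ u))) (y≢u ∘ sym)))

  private
    G′ = G ∖ Aᴳ

  avoids-A : ∀ {e v} → e ∈ edges G′ → Incident G e v → v ∉ Aᴳ
  avoids-A e∈ inc = x∈∁p⇒x∉p (within-incident {G = G} (proj₂ (induced-edge⁻ {G = G} e∈)) inc)

  -- A matching of `G′` misses all of `Aᴳ`. Setting one vertex `a` apart as the extra vertex `u` in
  -- `deficit` leaves a set of size one less than `Aᴳ`, and the strict inequality makes up for that.
  reduced-bound : ∀ {L M} → IsMatching G′ L → IsMaximumMatching G M → ∣ L ∣ + ∣ Aᴳ ∣ ≤ ∣ M ∣
  reduced-bound {L} {M} μ M-max with nonempty? (Aᴳ)
  ... | no empty = subst (_≤ ∣ M ∣)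
          (sym (trans (cong (∣ L ∣ +_) (trans (cong ∣_∣ (Empty-unique empty)) (∣⊥∣≡0 n))) (+-identityʳ _)))
                         (proj₂ M-max L (induced-matching⁻ μ))
  ... | yes (a , a∈A) = subst (_≤ ∣ M ∣) (trans (sym (+-suc ∣ L ∣ _)) (cong (∣ L ∣ +_) (∣p-x∣ Aᴳ a∈A)))
          (deficit _ (Aᴳ - a) a refl (x∈p-y⇒x∈p (Aᴳ)) (proj₁ (∈A⁻ a∈A)) (A∌D a∈A) (λ a∈ → x∈p-y⇒x≢y Aᴳ a∈ refl)
             (induced-matching⁻ μ) (λ x∈ → missed (x∈p-y⇒x∈p Aᴳ x∈)) (missed a∈A) M-max)
    where
    missed : ∀ {x} → x ∈ Aᴳ → Missed G L x
    missed x∈A (e , e∈L , inc) = avoids-A (areEdges μ e e∈L) inc x∈A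

  module _ {M} (M-max : IsMaximumMatching G M) where

    private
      M° = M ∩ edges G′
      M₁ = M ∩ ∁ (edges G′)

      M₁⇒M : M₁ ⊆ M
      M₁⇒M = p∩q⊆p M _

      μ₁ : IsMatching G M₁
      μ₁ = matching-⊆ M₁⇒M (proj₁ M-max)

      M₁-hits : Hits {F = G} Aᴳ M₁
      M₁-hits e e∈ with proj₁ (ends G e) ∈? Aᴳ | proj₂ (ends G e) ∈? Aᴳ
      ... | yes s∈ | _      = _ , s∈ , inj₁ refl
      ... | no _   | yes t∈ = _ , t∈ , inj₂ refl
      ... | no s∉  | no t∉  = ⊥-elim (x∈∁p⇒x∉p (p∩q⊆q M _ e∈)
        (induced-edge⁺ {G = G} (areEdges (proj₁ M-max) e (M₁⇒M e∈)) (x∉p⇒x∈∁p s∉ , x∉p⇒x∈∁p t∉)))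

    reduced-matching : IsMatching G′ M°
    reduced-matching = induced-matching⁺ (matching-⊆ (p∩q⊆p M _) (proj₁ M-max)) (p∩q⊆q M _)

    ∣A∣≤∣M─reduced∣ : ∣ Aᴳ ∣ ≤ ∣ M₁ ∣
    ∣A∣≤∣M─reduced∣ = +-cancelˡ-≤ ∣ M° ∣ _ _
      (subst (∣ M° ∣ + ∣ Aᴳ ∣ ≤_) (sym (∣p∩q∣+∣p∩∁q∣ M (edges G′))) (reduced-bound reduced-matching M-max))

    ∣M∣≤∣reduced∣+∣A∣ : ∣ M ∣ ≤ ∣ M° ∣ + ∣ Aᴳ ∣
    ∣M∣≤∣reduced∣+∣A∣ = subst (_≤ ∣ M° ∣ + ∣ Aᴳ ∣) (∣p∩q∣+∣p∩∁q∣ M (edges G′))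
      (+-monoʳ-≤ ∣ M° ∣ (hits⇒∣M∣≤∣S∣ M₁ μ₁ Aᴳ M₁-hits))

    -- The edges of `M` outside `G′` are covered by `Aᴳ`, so at most that many are lost, while
    -- `reduced-bound` leaves every matching of `G′` at least that far below `M`.
    reduced-maximum : IsMaximumMatching G′ M°
    reduced-maximum = reduced-matching
      , λ L λ′ → +-cancelʳ-≤ ∣ Aᴳ ∣ _ _ (≤-trans (reduced-bound λ′ M-max) ∣M∣≤∣reduced∣+∣A∣)

    -- `M` has at least as many edges meeting `Aᴳ` as `Aᴳ` has vertices, and an edge with both ends
    -- there would waste one of them.
    no-edge-within-A : ∀ {e} → e ∈ M → ¬ Within G Aᴳ e
    no-edge-within-A e∈M e⊆A = <⇒≱ (hits⇒∣M∣<∣S∣ μ₁ M₁-hits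
      (x∈p∩q⁺ (e∈M , x∉p⇒x∈∁p λ e∈ → avoids-A e∈ (inj₁ refl) (proj₁ e⊆A))) e⊆A) ∣A∣≤∣M─reduced∣

    -- A missed `v` could serve as the extra vertex in `deficit` with `T` all of `Aᴳ`, making `M°`
    -- too small.
    reduced-saturates-C : ∀ {v} → v ∈ Cᴳ → Saturates G M° v
    reduced-saturates-C {v} v∈C with saturates? G M° v
    ... | yes sat = sat
    ... | no miss = ⊥-elim (<⇒≱ (deficit _ Aᴳ v refl id (proj₁ (∈C⁻ v∈C)) (C∌D v∈C) (C∌A v∈C)
            (induced-matching⁻ reduced-matching) (λ { x∈A (e , e∈ , inc) → avoids-A (p∩q⊆q M _ e∈) inc x∈A }) miss M-max)
            ∣M∣≤∣reduced∣+∣A∣)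

  D⇒reduced-inessential : ∀ {v} → v ∈ Dᴳ → Inessential {F = G′} v
  D⇒reduced-inessential v∈D = let _ , N , N-max , v-missed = ∈D⁻ v∈D in
    N ∩ edges G′ , reduced-maximum N-max , missed-⊆ {F = G} (p∩q⊆p N _) v-missed

-- Maximum matchings cut into their parts in `H`, in C(G) and in the blocks.

module Decomposition {n m r} {G : Graph n m} {Dᴳ Aᴳ Cᴳ : Subset n} (ge : GallaiEdmonds G Dᴳ Aᴳ Cᴳ)
                     {B : Fin r → Subset n} (components : IsComponentList (G [ Dᴳ ]) B) where

  open IsMatching
  open GallaiEdmonds ge
  open Structure ge
  open IsComponentList components

  Hᴳ : Graph (n + r) m
  Hᴳ = contract (deleteEdgesWithin (G ∖ Cᴳ) Aᴳ) B

  private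
    G′ = G ∖ Aᴳ

    Path = Star (Adjacent (G [ Dᴳ ]))

    adjacent-sym : ∀ {u v} → Adjacent (G [ Dᴳ ]) u v → Adjacent (G [ Dᴳ ]) v u
    adjacent-sym (e , e∈ , e-uv) = e , e∈ , [ inj₂ , inj₁ ]′ e-uv

    adjacent⇒∈D : ∀ {u v} → Adjacent (G [ Dᴳ ]) u v → v ∈ Dᴳ
    adjacent⇒∈D (e , e∈ , e-uv) = within-incident {G = G} (proj₂ (induced-edge⁻ {G = G} e∈))
      (joins⇒incidentʳ {F = G} {e = e} e-uv)

    path⇒∈D : ∀ {u v} → u ∈ Dᴳ → Path u v → v ∈ Dᴳ
    path⇒∈D u∈D ε        = u∈D
    path⇒∈D u∈D (uv ◅ p) = path⇒∈D (adjacent⇒∈D uv) p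

    root∈D : ∀ i → proj₁ (component i) ∈ Dᴳ
    root∈D i = p∩q⊆q (vertices G) Dᴳ (proj₁ (proj₂ (component i)))

    fromRoot : ∀ {i v} → v ∈ B i → Path (proj₁ (component i)) v
    fromRoot {i} = Equivalence.to (proj₂ (proj₂ (component i)) _)

    toBlock : ∀ {i v} → Path (proj₁ (component i)) v → v ∈ B i
    toBlock {i} = Equivalence.from (proj₂ (proj₂ (component i)) _)

    path : ∀ {i u v} → u ∈ B i → v ∈ B i → Path u v
    path u∈ v∈ = reverse adjacent-sym (fromRoot u∈) ◅◅ fromRoot v∈

  root∈block : ∀ i → proj₁ (component i) ∈ B i
  root∈block i = toBlock ε

  block⊆D : ∀ {i v} → v ∈ B i → v ∈ Dᴳ
  block⊆D {i} v∈ = path⇒∈D (root∈D i) (fromRoot v∈)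

  block-unique : ∀ {i j v} → v ∈ B i → v ∈ B j → i ≡ j
  block-unique v∈i v∈j = distinct (⊆-antisym (transfer v∈i v∈j) (transfer v∈j v∈i))
    where
    transfer : ∀ {i j v} → v ∈ B i → v ∈ B j → B i ⊆ B j
    transfer v∈i v∈j u∈i = toBlock (fromRoot v∈j ◅◅ path v∈i u∈i)

  ∈D⇒block : ∀ {v} → v ∈ Dᴳ → ∃ λ i → v ∈ B i
  ∈D⇒block v∈D = covering _ (x∈p∩q⁺ (proj₁ (∈D⁻ v∈D) , v∈D))

  block-closed : ∀ {i u v} → u ∈ B i → Adjacent (G [ Dᴳ ]) u v → v ∈ B i
  block-closed u∈ uv = toBlock (fromRoot u∈ ◅◅ (uv ◅ ε))

  -- Gallai's lemma: the relation holds along each edge of a path inside the block, and transitivity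
  -- applies because every vertex on the way is inessential in `G′` too.
  block-neverBothMissed : ∀ {i u v} → u ∈ B i → v ∈ B i → NeverBothMissed {F = G′} u v
  block-neverBothMissed u∈ v∈ = along (path u∈ v∈)
    where
    reduced-adjacent : ∀ {u v} → Adjacent (G [ Dᴳ ]) u v → Adjacent G′ u v
    reduced-adjacent (e , e∈ , e-uv) =
      let e∈G , s∈D , t∈D = induced-edge⁻ {G = G} e∈ in
      e , induced-edge⁺ {G = G} e∈G (x∉p⇒x∈∁p (λ s∈A → A∌D s∈A s∈D) , x∉p⇒x∈∁p (λ t∈A → A∌D t∈A t∈D)) , e-uv
    along : ∀ {u v} → Path u v → NeverBothMissed {F = G′} u v
    along ε        = λ _ _ _ _ → refl
    along (uv ◅ p) = neverBothMissed-trans (D⇒reduced-inessential (adjacent⇒∈D uv))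
                       (adjacent⇒neverBothMissed {F = G′} (reduced-adjacent uv)) (along p)

  Cross : Fin m → Fin n → Fin n → Fin r → Set
  Cross e a d i = Joins G e a d × a ∈ Aᴳ × d ∈ B i

  data EdgeClass (e : Fin m) : Set where
    inC    : Within G Cᴳ e → EdgeClass e
    inB    : ∀ i → Within G (B i) e → EdgeClass e
    cross  : ∀ a d i → Cross e a d i → EdgeClass e
    inA    : Within G Aᴳ e → EdgeClass e
    acrossAC : ∀ a c → Joins G e a c → a ∈ Aᴳ → c ∈ Cᴳ → EdgeClass e

  -- No edge joins C(G) to D(G), since its end in C(G) would belong to A(G), and an edge inside D(G)
  -- stays in one component.
  edgeClass : ∀ {e} → e ∈ edges G → EdgeClass e
  edgeClass {e} e∈G with partition (proj₁ (closed G e∈G)) | partition (proj₂ (closed G e∈G))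
  ... | inj₁ s∈C        | inj₁ t∈C        = inC (s∈C , t∈C)
  ... | inj₁ s∈C        | inj₂ (inj₁ t∈A) = acrossAC _ _ (inj₂ refl) t∈A s∈C
  ... | inj₁ s∈C        | inj₂ (inj₂ t∈D) =
    ⊥-elim (C∌A s∈C (∈A⁺ (proj₁ (closed G e∈G)) (C∌D s∈C) t∈D (e , e∈G , inj₁ refl)))
  ... | inj₂ (inj₁ s∈A) | inj₁ t∈C        = acrossAC _ _ (inj₁ refl) s∈A t∈C
  ... | inj₂ (inj₁ s∈A) | inj₂ (inj₁ t∈A) = inA (s∈A , t∈A)
  ... | inj₂ (inj₁ s∈A) | inj₂ (inj₂ t∈D) = let i , t∈B = ∈D⇒block t∈D in cross _ _ i (inj₁ refl , s∈A , t∈B)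
  ... | inj₂ (inj₂ s∈D) | inj₁ t∈C        =
    ⊥-elim (C∌A t∈C (∈A⁺ (proj₂ (closed G e∈G)) (C∌D t∈C) s∈D (e , e∈G , inj₂ refl)))
  ... | inj₂ (inj₂ s∈D) | inj₂ (inj₁ t∈A) = let i , s∈B = ∈D⇒block s∈D in cross _ _ i (inj₂ refl , t∈A , s∈B)
  ... | inj₂ (inj₂ s∈D) | inj₂ (inj₂ t∈D) = let i , s∈B = ∈D⇒block s∈D in
    inB i (s∈B , block-closed s∈B (e , induced-edge⁺ {G = G} e∈G (s∈D , t∈D) , inj₁ refl))

  image-block : ∀ {v i} → v ∈ B i → image B v ≡ n ↑ʳ i
  image-block {v} v∈i with inBlock? B v
  ... | yes (j , v∈j) = cong (n ↑ʳ_) (block-unique v∈j v∈i)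
  ... | no v∉         = ⊥-elim (v∉ (_ , v∈i))

  image-A : ∀ {v} → v ∈ Aᴳ → image B v ≡ v ↑ˡ r
  image-A {v} v∈A with inBlock? B v
  ... | yes (j , v∈j) = ⊥-elim (A∌D v∈A (block⊆D v∈j))
  ... | no v∉         = refl

  cross-joins : ∀ {e a d i} → Cross e a d i → Joins Hᴳ e (a ↑ˡ r) (n ↑ʳ i)
  cross-joins (inj₁ refl , a∈ , d∈) = inj₁ (cong₂ _,_ (image-A a∈) (image-block d∈))
  cross-joins (inj₂ refl , a∈ , d∈) = inj₂ (cong₂ _,_ (image-block d∈) (image-A a∈))

  private
    K = deleteEdgesWithin (G ∖ Cᴳ) Aᴳ

    kept₁? : Decidable (λ e → e ∈ edges (G ∖ Cᴳ) × ¬ Within (G ∖ Cᴳ) Aᴳ e)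
    kept₁? e = (e ∈? edges (G ∖ Cᴳ)) ×-dec ¬? (within? (G ∖ Cᴳ) Aᴳ e)

    kept₂? : Decidable (λ e → e ∈ edges K × ¬ (∃ λ i → Within K (B i) e))
    kept₂? e = (e ∈? edges K) ×-dec ¬? (any? λ i → within? K (B i) e)

  cross⇒∈H : ∀ {e a d i} → e ∈ edges G → Cross e a d i → e ∈ edges Hᴳ
  cross⇒∈H {e} {a} {d} {i} e∈G (e-ad , a∈ , d∈) = ∈⟪⟫⁺ kept₂?
    ( ∈⟪⟫⁺ kept₁? ( induced-edge⁺ {G = G} e∈G (notC _ (inj₁ refl) , notC _ (inj₂ refl))
                  , λ within → A∌D (within-incident {G = G} within (joins⇒incidentʳ {F = G} {e = e} e-ad)) (block⊆D d∈))
    , λ (j , within) → A∌D a∈ (block⊆D (within-incident {G = G} within (joins⇒incidentˡ {F = G} {e = e} e-ad))))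
    where
    notC : ∀ v → Incident G e v → v ∈ ∁ Cᴳ
    notC v inc with incident-joins {F = G} {e = e} e-ad inc
    ... | inj₁ refl = x∉p⇒x∈∁p λ a∈C → C∌A a∈C a∈
    ... | inj₂ refl = x∉p⇒x∈∁p λ d∈C → C∌D d∈C (block⊆D d∈)

  ∈H⇒edge : ∀ {e} → e ∈ edges Hᴳ → e ∈ edges G
  ∈H⇒edge e∈H = proj₁ (induced-edge⁻ {G = G} (proj₁ (∈⟪⟫⁻ kept₁? (proj₁ (∈⟪⟫⁻ kept₂? e∈H)))))

  ∈H⇒cross : ∀ {e} → e ∈ edges Hᴳ → ∃ λ a → ∃ λ d → ∃ λ i → Cross e a d i
  ∈H⇒cross {e} e∈H with ∈⟪⟫⁻ kept₂? e∈H
  ... | e∈K , ¬inB with ∈⟪⟫⁻ kept₁? e∈K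
  ... | e∈G∖C , ¬inA with induced-edge⁻ {G = G} e∈G∖C
  ... | e∈G , s∉C , t∉C with edgeClass e∈G
  ... | inC (s∈C , _)             = ⊥-elim (x∈∁p⇒x∉p s∉C s∈C)
  ... | inB i within              = ⊥-elim (¬inB (i , within))
  ... | cross a d i c             = a , d , i , c
  ... | inA within                = ⊥-elim (¬inA within)
  ... | acrossAC a c (inj₁ refl) _ c∈ = ⊥-elim (x∈∁p⇒x∉p t∉C c∈)
  ... | acrossAC a c (inj₂ refl) _ c∈ = ⊥-elim (x∈∁p⇒x∉p s∉C c∈)

  block : Fin r → Graph n m
  block i = G [ Dᴳ ] [ B i ]

  -- Edges inside A(G) and between A(G) and C(G) lie in no piece, since no maximum matching uses
  -- them. `H` comes first because the conditions on the blocks depend on the part in `H`.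
  E : Fin (2 + r) → Subset m
  E zero          = edges Hᴳ
  E (suc zero)    = edges (G [ Cᴳ ])
  E (suc (suc i)) = edges (block i)

  ∈block⁺ : ∀ {e i} → e ∈ edges G → Within G (B i) e → e ∈ edges (block i)
  ∈block⁺ e∈G (s∈ , t∈) = induced-edge⁺ {G = G [ Dᴳ ]} (induced-edge⁺ {G = G} e∈G (block⊆D s∈ , block⊆D t∈)) (s∈ , t∈)

  ∈block⁻ : ∀ {e i} → e ∈ edges (block i) → e ∈ edges G × Within G (B i) e
  ∈block⁻ e∈ = let e∈GD , within = induced-edge⁻ {G = G [ Dᴳ ]} e∈ in proj₁ (induced-edge⁻ {G = G} e∈GD) , within

  private
    C≁H : ∀ {e} → e ∈ edges (G [ Cᴳ ]) → e ∉ edges Hᴳ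
    C≁H {e} e∈C e∈H = let a , d , i , (e-ad , a∈ , d∈) = ∈H⇒cross e∈H in
      C∌A (within-incident {G = G} (proj₂ (induced-edge⁻ {G = G} e∈C)) (joins⇒incidentˡ {F = G} {e = e} e-ad)) a∈

    B≁H : ∀ {i e} → e ∈ edges (block i) → e ∉ edges Hᴳ
    B≁H {e = e} e∈B e∈H = let a , d , i , (e-ad , a∈ , d∈) = ∈H⇒cross e∈H in
      A∌D a∈ (block⊆D (within-incident {G = G} (proj₂ (∈block⁻ e∈B)) (joins⇒incidentˡ {F = G} {e = e} e-ad)))

    B≁C : ∀ {i e} → e ∈ edges (block i) → e ∉ edges (G [ Cᴳ ])
    B≁C e∈B e∈C = C∌D (proj₁ (proj₂ (induced-edge⁻ {G = G} e∈C))) (block⊆D (proj₁ (proj₂ (∈block⁻ e∈B))))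

  E-disjoint : Disjoint E
  E-disjoint {zero}        {zero}        _   _   = refl
  E-disjoint {zero}        {suc zero}    e∈H e∈C = ⊥-elim (C≁H e∈C e∈H)
  E-disjoint {zero}        {suc (suc j)} e∈H e∈B = ⊥-elim (B≁H e∈B e∈H)
  E-disjoint {suc zero}    {zero}        e∈C e∈H = ⊥-elim (C≁H e∈C e∈H)
  E-disjoint {suc zero}    {suc zero}    _   _   = refl
  E-disjoint {suc zero}    {suc (suc j)} e∈C e∈B = ⊥-elim (B≁C e∈B e∈C)
  E-disjoint {suc (suc i)} {zero}        e∈B e∈H = ⊥-elim (B≁H e∈B e∈H)
  E-disjoint {suc (suc i)} {suc zero}    e∈B e∈C = ⊥-elim (B≁C e∈B e∈C)
  E-disjoint {suc (suc i)} {suc (suc j)} e∈i e∈j =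
    cong (λ k → Fin.suc (Fin.suc k)) (block-unique (proj₁ (proj₂ (∈block⁻ e∈i))) (proj₁ (proj₂ (∈block⁻ e∈j))))

  -- This merges the two cases of the formula: v is w_i(M′) if M′ covers B i, and
  -- any vertex of B i otherwise.
  Exposable : Subset m → Fin r → Fin n → Set
  Exposable M′ i v = ∀ e → e ∈ M′ → Incident Hᴳ e (n ↑ʳ i) → Incident G e v

  NearPerfect : Subset m → Fin r → Subset m → Set
  NearPerfect M′ i L = ∃ λ v → v ∈ B i × Exposable M′ i v × IsPerfectMatching (block i − v) L

  record Decomposed (M : Subset m) : Set where
    field
      covered : Covered E M
      atH     : IsMaximumMatching Hᴳ (M ∩ edges Hᴳ)
      atC     : IsPerfectMatching (G [ Cᴳ ]) (M ∩ edges (G [ Cᴳ ]))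
      atB     : ∀ i → NearPerfect (M ∩ edges Hᴳ) i (M ∩ edges (block i))

  -- Every edge of `H` has an end in A(G), so that side is a vertex cover.
  H-matching-bound : ∀ {M} → IsMatching Hᴳ M → ∣ M ∣ ≤ ∣ Aᴳ ∣
  H-matching-bound {M} μ = subst (∣ M ∣ ≤_) (∣p++⊥∣ Aᴳ r) (hits⇒∣M∣≤∣S∣ M μ (Aᴳ ++ ⊥)
    λ e e∈M → let a , d , i , c@(_ , a∈ , _) = ∈H⇒cross (areEdges μ e e∈M) in
      a ↑ˡ r , ∈-++⁺ˡ a∈ , joins⇒incidentˡ {F = Hᴳ} {e = e} (cross-joins c))

  crossing-incident : ∀ {e a d i v} → Cross e a d i → Incident G e v → v ∈ Dᴳ → v ≡ d
  crossing-incident {e} (e-ad , a∈ , _) inc v∈D with incident-joins {F = G} {e = e} e-ad inc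
  ... | inj₁ refl = ⊥-elim (A∌D a∈ v∈D)
  ... | inj₂ v≡d  = v≡d

  crossing-block : ∀ {e a d i j} → Cross e a d i → Incident Hᴳ e (n ↑ʳ j) → i ≡ j
  crossing-block {e} {a} {i = i} {j} c inc with incident-joins {F = Hᴳ} {e = e} (cross-joins c) inc
  ... | inj₁ eq = ⊥-elim (↑ˡ≢↑ʳ a j (sym eq))
  ... | inj₂ eq = sym (↑ʳ-injective n j i eq)

  crossing-A : ∀ {e a d i b} → Cross e a d i → Incident Hᴳ e (b ↑ˡ r) → b ≡ a
  crossing-A {e} {a} {i = i} {b} c inc with incident-joins {F = Hᴳ} {e = e} (cross-joins c) inc
  ... | inj₁ eq = ↑ˡ-injective r b a eq
  ... | inj₂ eq = ⊥-elim (↑ˡ≢↑ʳ b i eq)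

  -- The parts of a maximum matching.

  module MaximumIsDecomposed {M} (M-max : IsMaximumMatching G M) where

    private
      μ  = proj₁ M-max
      M° = M ∩ edges G′
      Mᴴ = M ∩ edges Hᴳ

      M°⇒M : M° ⊆ M
      M°⇒M = p∩q⊆p M _

    -- The only edge of `M` at `d` is `e`, which meets A(G) and is therefore not in `M°`.
    crossing-missed : ∀ {e a d i} → e ∈ M → Cross e a d i → Missed G M° d
    crossing-missed {e} e∈M (e-ad , a∈ , _) (f , f∈ , inc) =
      avoids-A (p∩q⊆q M _ f∈) (subst (λ g → Incident G g _) e≡f (joins⇒incidentˡ {F = G} {e = e} e-ad)) a∈
      where
      e≡f : e ≡ f
      e≡f = disjoint μ e f e∈M (M°⇒M f∈) _ (joins⇒incidentʳ {F = G} {e = e} e-ad) inc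

    -- `M°` saturates `c` by an edge avoiding A(G); this edge shares `c` with `e` and hence equals
    -- it.
    no-edge-acrossAC : ∀ {e a c} → e ∈ M → Joins G e a c → a ∈ Aᴳ → c ∉ Cᴳ
    no-edge-acrossAC {e} e∈M e-ac a∈ c∈ =
      let f , f∈ , inc = reduced-saturates-C M-max c∈
          e≡f = disjoint μ e f e∈M (M°⇒M f∈) _ (joins⇒incidentʳ {F = G} {e = e} e-ac) inc
      in avoids-A (p∩q⊆q M _ f∈) (subst (λ g → Incident G g _) e≡f (joins⇒incidentˡ {F = G} {e = e} e-ac)) a∈

    covered : Covered E M
    covered e e∈M with edgeClass (areEdges μ e e∈M)
    ... | inC within              = suc zero , induced-edge⁺ {G = G} (areEdges μ e e∈M) within
    ... | inB i within            = suc (suc i) , ∈block⁺ (areEdges μ e e∈M) within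
    ... | cross a d i c           = zero , cross⇒∈H (areEdges μ e e∈M) c
    ... | inA within              = ⊥-elim (no-edge-within-A M-max e∈M within)
    ... | acrossAC a c e-ac a∈ c∈ = ⊥-elim (no-edge-acrossAC e∈M e-ac a∈ c∈)

    H-matching : IsMatching Hᴳ Mᴴ
    H-matching = record
      { areEdges = λ e → p∩q⊆q M _
      ; nonLoop  = λ e e∈ → let a , d , i , c = ∈H⇒cross (p∩q⊆q M _ e∈) in
          ≢⇒nonLoop {F = Hᴳ} {e = e} (cross-joins c) (↑ˡ≢↑ʳ a i)
      ; disjoint = dis
      }
      where
      dis : ∀ e f → e ∈ Mᴴ → f ∈ Mᴴ → ∀ x → Incident Hᴳ e x → Incident Hᴳ f x → e ≡ f
      dis e f e∈ f∈ x e-x f-x with ∈H⇒cross (p∩q⊆q M _ e∈) | ∈H⇒cross (p∩q⊆q M _ f∈)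
      ... | a , d , i , c@(e-ad , _ , d∈) | a′ , d′ , i′ , c′@(f-ad , _ , d′∈)
        with incident-joins {F = Hᴳ} {e = e} (cross-joins c) e-x
      ... | inj₁ refl = disjoint μ e f (p∩q⊆p M _ e∈) (p∩q⊆p M _ f∈) a (joins⇒incidentˡ {F = G} {e = e} e-ad)
              (subst (Incident G f) (sym (crossing-A c′ f-x)) (joins⇒incidentˡ {F = G} {e = f} f-ad))
      ... | inj₂ refl = disjoint μ e f (p∩q⊆p M _ e∈) (p∩q⊆p M _ f∈) d (joins⇒incidentʳ {F = G} {e = e} e-ad)
              (subst (Incident G f) (sym d≡d′) (joins⇒incidentʳ {F = G} {e = f} f-ad))
        where
        -- Two edges of `M` into one block end in vertices that `M°` misses, so Gallai's lemma
        -- identifies these ends. Thus contracting the block creates no second edge at its vertex.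
        d≡d′ : d ≡ d′
        d≡d′ = block-neverBothMissed d∈ (subst (λ j → d′ ∈ B j) (crossing-block c′ f-x) d′∈) M° (reduced-maximum M-max)
          (crossing-missed (p∩q⊆p M _ e∈) c) (crossing-missed (p∩q⊆p M _ f∈) c′)

    -- All edges of `M` meeting A(G) lie in `H`, and they are at least as many as the vertices of
    -- A(G), which is the upper bound for matchings of `H`.
    atH : IsMaximumMatching Hᴳ Mᴴ
    atH = H-matching , λ N ν → ≤-trans (H-matching-bound ν)
      (≤-trans (∣A∣≤∣M─reduced∣ M-max) (p⊆q⇒∣p∣≤∣q∣ crossing))
      where
      crossing : M ∩ ∁ (edges G′) ⊆ Mᴴ
      crossing {e} e∈ with x∈p∩q⁻ M _ e∈
      ... | e∈M , e∉G′ with edgeClass (areEdges μ e e∈M)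
      ... | inC (s∈ , t∈)           = ⊥-elim (x∈∁p⇒x∉p e∉G′ (induced-edge⁺ {G = G} (areEdges μ e e∈M)
                                        (x∉p⇒x∈∁p (C∌A s∈) , x∉p⇒x∈∁p (C∌A t∈))))
      ... | inB i (s∈ , t∈)         = ⊥-elim (x∈∁p⇒x∉p e∉G′ (induced-edge⁺ {G = G} (areEdges μ e e∈M)
                                        (x∉p⇒x∈∁p (λ s∈A → A∌D s∈A (block⊆D s∈)) , x∉p⇒x∈∁p (λ t∈A → A∌D t∈A (block⊆D t∈)))))
      ... | cross a d i c           = x∈p∩q⁺ (e∈M , cross⇒∈H (areEdges μ e e∈M) c)
      ... | inA within              = ⊥-elim (no-edge-within-A M-max e∈M within)
      ... | acrossAC a c e-ac a∈ c∈ = ⊥-elim (no-edge-acrossAC e∈M e-ac a∈ c∈)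

    atC : IsPerfectMatching (G [ Cᴳ ]) (M ∩ edges (G [ Cᴳ ]))
    atC = induced-matching⁺ (matching-⊆ (p∩q⊆p M _) μ) (p∩q⊆q M _) , saturates
      where
      saturates : ∀ v → v ∈ vertices G ∩ Cᴳ → Saturates G (M ∩ edges (G [ Cᴳ ])) v
      saturates v v∈ with p∩q⊆q (vertices G) Cᴳ v∈
      ... | v∈C with reduced-saturates-C M-max v∈C
      ... | e , e∈ , inc with edgeClass (areEdges μ e (M°⇒M e∈))
      ... | inC within                = e , x∈p∩q⁺ (M°⇒M e∈ , induced-edge⁺ {G = G} (areEdges μ e (M°⇒M e∈)) within) , inc
      ... | inB i within              = ⊥-elim (C∌D v∈C (block⊆D (within-incident {G = G} within inc)))
      ... | cross a d i (e-ad , a∈ , _) = ⊥-elim (avoids-A (p∩q⊆q M _ e∈) (joins⇒incidentˡ {F = G} {e = e} e-ad) a∈)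
      ... | inA within                = ⊥-elim (no-edge-within-A M-max (M°⇒M e∈) within)
      ... | acrossAC a c e-ac a∈ c∈   = ⊥-elim (no-edge-acrossAC (M°⇒M e∈) e-ac a∈ c∈)

    block-saturates : ∀ {i v} → v ∈ B i → Saturates G M° v → Saturates G (M ∩ edges (block i)) v
    block-saturates {i} {v} v∈ (e , e∈ , inc) with edgeClass (areEdges μ e (M°⇒M e∈))
    ... | inC within                = ⊥-elim (C∌D (within-incident {G = G} within inc) (block⊆D v∈))
    ... | inB j within with block-unique v∈ (within-incident {G = G} within inc)
    ... | refl                      = e , x∈p∩q⁺ (M°⇒M e∈ , ∈block⁺ (areEdges μ e (M°⇒M e∈)) within) , inc
    block-saturates v∈ (e , e∈ , inc)
        | cross a d i (e-ad , a∈ , _) = ⊥-elim (avoids-A (p∩q⊆q M _ e∈) (joins⇒incidentˡ {F = G} {e = e} e-ad) a∈)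
    block-saturates v∈ (e , e∈ , inc)
        | inA within                = ⊥-elim (no-edge-within-A M-max (M°⇒M e∈) within)
    block-saturates v∈ (e , e∈ , inc)
        | acrossAC a c e-ac a∈ c∈   = ⊥-elim (no-edge-acrossAC (M°⇒M e∈) e-ac a∈ c∈)

    block-matching : ∀ i → IsMatching (block i) (M ∩ edges (block i))
    block-matching i = induced-matching⁺ {G = G [ Dᴳ ]}
      (induced-matching⁺ (matching-⊆ (p∩q⊆p M _) μ)
        (λ e∈ → proj₁ (induced-edge⁻ {G = G [ Dᴳ ]} (p∩q⊆q M _ e∈))))
      (p∩q⊆q M _)

    -- By Gallai's lemma `v` is the only vertex of the block missed by `M°`, and an edge of `M°` at
    -- a vertex of the block stays inside the block.
    near-perfect : ∀ {i v} → v ∈ B i → Missed G M° v → IsPerfectMatching (block i − v) (M ∩ edges (block i))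
    near-perfect {i} {v} v∈ v-missed = induced-matching⁺ {G = block i} (block-matching i) avoids , saturates
      where
      M°∌ : ∀ {e} → e ∈ M ∩ edges (block i) → e ∈ M°
      M°∌ e∈ = let e∈M , e∈B = x∈p∩q⁻ M _ e∈ ; e∈G , s∈ , t∈ = ∈block⁻ e∈B in
        x∈p∩q⁺ (e∈M , induced-edge⁺ {G = G} e∈G
          (x∉p⇒x∈∁p (λ s∈A → A∌D s∈A (block⊆D s∈)) , x∉p⇒x∈∁p (λ t∈A → A∌D t∈A (block⊆D t∈))))
      avoids : M ∩ edges (block i) ⊆ edges (block i − v)
      avoids {e} e∈ = induced-edge⁺ {G = block i} (p∩q⊆q M _ e∈)
        ( x∉p⇒x∈∁p (λ s∈ → v-missed (e , M°∌ e∈ , inj₁ (x∈⁅y⁆⇒x≡y v s∈)))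
        , x∉p⇒x∈∁p (λ t∈ → v-missed (e , M°∌ e∈ , inj₂ (x∈⁅y⁆⇒x≡y v t∈))))
      saturates : ∀ u → u ∈ vertices (block i − v) → Saturates G (M ∩ edges (block i)) u
      saturates u u∈ with saturates? G M° u | x∈p∩q⁻ (vertices (block i)) _ u∈
      ... | yes sat | u∈B , _ = block-saturates (p∩q⊆q _ (B i) u∈B) sat
      ... | no miss | u∈B , u∉v = ⊥-elim (x∈∁p⇒x∉p u∉v (subst (_∈ ⁅ v ⁆)
              (block-neverBothMissed v∈ (p∩q⊆q _ (B i) u∈B) M° (reduced-maximum M-max) v-missed miss) (x∈⁅x⁆ v)))

  block⊆vertices : ∀ {i v} → v ∈ B i → v ∈ vertices (block i)
  block⊆vertices v∈ = x∈p∩q⁺ (x∈p∩q⁺ (proj₁ (∈D⁻ (block⊆D v∈)) , block⊆D v∈) , v∈)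

  near-perfect-size : ∀ {i v L} → v ∈ B i → IsPerfectMatching (block i − v) L → suc (2 * ∣ L ∣) ≡ ∣ vertices (block i) ∣
  near-perfect-size {i} v∈ pm = trans (cong suc (perfect-size pm)) (∣p∩∁⁅x⁆∣ (vertices (block i)) (block⊆vertices v∈))

  maximum⇒decomposed : ∀ {M} → IsMaximumMatching G M → Decomposed M
  maximum⇒decomposed {M} M-max = record
    { covered = covered
    ; atH = atH
    ; atC = atC
    ; atB = λ i → let v , v∈ , v-missed = exposed i in
        v , v∈ , exposable v∈ v-missed , near-perfect v∈ v-missed
    }
    where
    open MaximumIsDecomposed M-max
    M° = M ∩ edges G′

    -- An edge of `M` entering the block ends in a vertex missed by `M°`, and only `v` is such a
    -- vertex.
    exposable : ∀ {i v} → v ∈ B i → Missed G M° v → Exposable (M ∩ edges Hᴳ) i v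
    exposable {i} v∈ v-missed e e∈ inc with ∈H⇒cross (p∩q⊆q M _ e∈)
    ... | a , d , j , c@(e-ad , _ , d∈) with crossing-block c inc
    ... | refl = subst (Incident G e) (block-neverBothMissed d∈ v∈ M° (reduced-maximum M-max)
                   (crossing-missed (p∩q⊆p M _ e∈) c) v-missed) (joins⇒incidentʳ {F = G} {e = e} e-ad)

    -- A block of odd order cannot be perfectly matched within itself; its order
    -- is odd because some maximum matching leaves out a vertex of the block.
    exposed : ∀ i → ∃ λ v → v ∈ B i × Missed G M° v
    exposed i with any? (λ v → (v ∈? B i) ×-dec ¬? (saturates? G M° v))
    ... | yes v = v
    ... | no ¬v = ⊥-elim (odd (∈D⁻ (block⊆D (root∈block i))))
      where
      t = proj₁ (component i)
      perfect : IsPerfectMatching (block i) (M ∩ edges (block i))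
      perfect = block-matching i , λ v v∈ → block-saturates (p∩q⊆q _ (B i) v∈)
        (decidable-stable (saturates? G M° v) λ miss → ¬v (v , p∩q⊆q _ (B i) v∈ , miss))
      odd : ¬ (t ∈ vertices G × Inessential {F = G} t)
      odd (_ , N , N-max , t-missed) = even≢odd ∣ M ∩ edges (block i) ∣ ∣ N ∩ edges (block i) ∣
        (trans (perfect-size perfect)
        (sym (near-perfect-size (root∈block i) (MaximumIsDecomposed.near-perfect N-max (root∈block i)
          (missed-⊆ {F = G} (p∩q⊆p N _) t-missed)))))

  -- Each part has a forced size: the maximum for `H`, half the order of C(G), and half of one less
  -- than the order of each block, whichever vertex is left out.
  decomposed-size : ∀ {M N} → Decomposed M → Decomposed N → ∣ M ∣ ≡ ∣ N ∣
  decomposed-size {M} {N} δ ε′ = ∣∣-piecewise E E-disjoint (covered δ) (covered ε′) pieces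
    where
    open Decomposed
    pieces : ∀ c → ∣ M ∩ E c ∣ ≡ ∣ N ∩ E c ∣
    pieces zero          = maximum-size (atH δ) (atH ε′)
    pieces (suc zero)    = *-cancelˡ-≡ _ _ 2 (trans (perfect-size (atC δ)) (sym (perfect-size (atC ε′))))
    pieces (suc (suc i)) =
      let v , v∈ , _ , pm = atB δ i
          u , u∈ , _ , qm = atB ε′ i
      in *-cancelˡ-≡ _ _ 2 (cong (_∸ 1) (trans (near-perfect-size v∈ pm) (sym (near-perfect-size u∈ qm))))

  -- Maximality comes by comparison: some maximum matching exists, it is decomposed, and all
  -- decomposed sets have the same size.
  decomposed⇒maximum : ∀ {M} → Decomposed M → IsMaximumMatching G M
  decomposed⇒maximum {M} δ = matching , maximum
    where
    open Decomposed δ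

    edge : ∀ {e c} → e ∈ E c → e ∈ edges G
    edge {c = zero}        e∈ = ∈H⇒edge e∈
    edge {c = suc zero}    e∈ = proj₁ (induced-edge⁻ {G = G} e∈)
    edge {c = suc (suc i)} e∈ = proj₁ (∈block⁻ e∈)

    loopless : ∀ {e} → e ∈ M → ∀ c → e ∈ E c → ¬ Loop G e
    loopless e∈M zero e∈ = let a , d , i , (e-ad , a∈ , d∈) = ∈H⇒cross e∈ in
      ≢⇒nonLoop {F = G} e-ad λ a≡d → A∌D a∈ (block⊆D (subst (_∈ B i) (sym a≡d) d∈))
    loopless e∈M (suc zero)    e∈ = nonLoop (proj₁ atC) _ (x∈p∩q⁺ (e∈M , e∈))
    loopless e∈M (suc (suc i)) e∈ = let _ , _ , _ , pm = atB i in nonLoop (proj₁ pm) _ (x∈p∩q⁺ (e∈M , e∈))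

    atC-edge : ∀ {e v} → v ∈ Cᴳ → Incident G e v → ∀ c → e ∈ E c → e ∈ E (suc zero)
    atC-edge {e} v∈ inc zero e∈ with ∈H⇒cross e∈
    ... | a , d , i , (e-ad , a∈ , d∈) with incident-joins {F = G} {e = e} e-ad inc
    ... | inj₁ refl = ⊥-elim (C∌A v∈ a∈)
    ... | inj₂ refl = ⊥-elim (C∌D v∈ (block⊆D d∈))
    atC-edge v∈ inc (suc zero)    e∈ = e∈
    atC-edge v∈ inc (suc (suc i)) e∈ = ⊥-elim (C∌D v∈ (block⊆D (within-incident {G = G} (proj₂ (∈block⁻ e∈)) inc)))

    atA-edge : ∀ {e v} → v ∈ Aᴳ → Incident G e v → ∀ c → e ∈ E c → e ∈ edges Hᴳ × Incident Hᴳ e (v ↑ˡ r)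
    atA-edge {e} v∈ inc zero e∈ with ∈H⇒cross e∈
    ... | a , d , i , c@(e-ad , a∈ , d∈) with incident-joins {F = G} {e = e} e-ad inc
    ... | inj₁ refl = e∈ , joins⇒incidentˡ {F = Hᴳ} {e = e} (cross-joins c)
    ... | inj₂ refl = ⊥-elim (A∌D v∈ (block⊆D d∈))
    atA-edge v∈ inc (suc zero)    e∈ = ⊥-elim (C∌A (within-incident {G = G} (proj₂ (induced-edge⁻ {G = G} e∈)) inc) v∈)
    atA-edge v∈ inc (suc (suc i)) e∈ = ⊥-elim (A∌D v∈ (block⊆D (within-incident {G = G} (proj₂ (∈block⁻ e∈)) inc)))

    atB-edge : ∀ {e v i} → v ∈ B i → Incident G e v → ∀ c → e ∈ E c →
               (e ∈ edges Hᴳ × Incident Hᴳ e (n ↑ʳ i)) ⊎ e ∈ edges (block i)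
    atB-edge {e} v∈ inc zero e∈ with ∈H⇒cross e∈
    ... | a , d , i , c@(e-ad , a∈ , d∈) with crossing-incident c inc (block⊆D v∈)
    ... | refl with block-unique d∈ v∈
    ... | refl = inj₁ (e∈ , joins⇒incidentʳ {F = Hᴳ} {e = e} (cross-joins c))
    atB-edge v∈ inc (suc zero)    e∈ = ⊥-elim (C∌D (within-incident {G = G} (proj₂ (induced-edge⁻ {G = G} e∈)) inc) (block⊆D v∈))
    atB-edge v∈ inc (suc (suc j)) e∈ with block-unique (within-incident {G = G} (proj₂ (∈block⁻ e∈)) inc) v∈
    ... | refl = inj₂ e∈

    -- Exposability forces the edge `e` of `H` to enter the block at the vertex left out there, so
    -- `x` is that vertex and no edge of the block part meets it.
    noClash : ∀ {e f x i} → x ∈ B i → e ∈ M → f ∈ M → Incident G e x → Incident G f x →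
              e ∈ edges Hᴳ → Incident Hᴳ e (n ↑ʳ i) → f ∉ edges (block i)
    noClash {e} {f} {x} {i} x∈ e∈M f∈M e-x f-x e∈H e-i f∈B with atB i
    ... | v , v∈ , exposable , (ν , _) with ∈H⇒cross e∈H
    ... | a , d , j , c with crossing-incident c e-x (block⊆D x∈)
                           | crossing-incident c (exposable e (x∈p∩q⁺ (e∈M , e∈H)) e-i) (block⊆D v∈)
    ... | refl | refl = x∈∁p⇒x∉p (within-incident {G = G} (proj₂ (induced-edge⁻ {G = block i}
                          (areEdges ν f (x∈p∩q⁺ (f∈M , f∈B))))) f-x) (x∈⁅x⁆ x)

    disjointness : ∀ e f → e ∈ M → f ∈ M → ∀ v → Incident G e v → Incident G f v → e ≡ f
    disjointness e f e∈M f∈M v e-v f-v with covered e e∈M | covered f f∈M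
    -- The class of the common vertex `v` decides in which pieces `e` and `f` can lie. They share a
    -- piece unless `v` is in a block that one edge enters from A(G), and `noClash` excludes that
    -- case.
    ... | c , e∈c | c′ , f∈c′ with partition (incident⇒vertex {F = G} (edge {c = c} e∈c) e-v)
    ... | inj₁ v∈C = disjoint (proj₁ atC) e f (x∈p∩q⁺ (e∈M , atC-edge v∈C e-v c e∈c))
                       (x∈p∩q⁺ (f∈M , atC-edge v∈C f-v c′ f∈c′)) v e-v f-v
    ... | inj₂ (inj₁ v∈A) =
      let e∈H , e-a = atA-edge v∈A e-v c e∈c
          f∈H , f-a = atA-edge v∈A f-v c′ f∈c′
      in disjoint (proj₁ atH) e f (x∈p∩q⁺ (e∈M , e∈H)) (x∈p∩q⁺ (f∈M , f∈H)) _ e-a f-a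
    ... | inj₂ (inj₂ v∈D) with ∈D⇒block v∈D
    ... | i , v∈i with atB-edge v∈i e-v c e∈c | atB-edge v∈i f-v c′ f∈c′
    ... | inj₁ (e∈H , e-i) | inj₁ (f∈H , f-i) =
            disjoint (proj₁ atH) e f (x∈p∩q⁺ (e∈M , e∈H)) (x∈p∩q⁺ (f∈M , f∈H)) _ e-i f-i
    ... | inj₁ (e∈H , e-i) | inj₂ f∈B = ⊥-elim (noClash v∈i e∈M f∈M e-v f-v e∈H e-i f∈B)
    ... | inj₂ e∈B | inj₁ (f∈H , f-i) = ⊥-elim (noClash v∈i f∈M e∈M f-v e-v f∈H f-i e∈B)
    ... | inj₂ e∈B | inj₂ f∈B = let _ , _ , _ , pm = atB i in
            disjoint (proj₁ pm) e f (x∈p∩q⁺ (e∈M , e∈B)) (x∈p∩q⁺ (f∈M , f∈B)) v e-v f-v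

    matching : IsMatching G M
    matching = record
      { areEdges = λ e e∈M → let c , e∈ = covered e e∈M in edge {c = c} e∈
      ; nonLoop  = λ e e∈M → let c , e∈ = covered e e∈M in loopless e∈M c e∈
      ; disjoint = disjointness
      }

    maximum : ∀ N → IsMatching G N → ∣ N ∣ ≤ ∣ M ∣
    maximum N ν = let N′ , N′-max = maximum-exists {F = G} in
      ≤-trans (proj₂ N′-max N ν) (≤-reflexive (decomposed-size (maximum⇒decomposed N′-max) δ))

  -- Counting

  exposable? : ∀ M′ i v → Dec (Exposable M′ i v)
  exposable? M′ i v = all? λ e → (e ∈? M′) →-dec incident? Hᴳ e (n ↑ʳ i) →-dec incident? G e v

  nearPerfect? : ∀ M′ i → Decidable (NearPerfect M′ i)
  nearPerfect? M′ i L = any? λ v → (v ∈? B i) ×-dec exposable? M′ i v ×-dec isPerfectMatching? (block i − v) L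

  -- Were they distinct, `L` would have to saturate `v` as a vertex of `block i − u` and to avoid it
  -- as a matching of `block i − v`.
  exposed-unique : ∀ {i u v L} → u ∈ B i → v ∈ B i →
                   IsPerfectMatching (block i − u) L → IsPerfectMatching (block i − v) L → u ≡ v
  exposed-unique {i} {u} {v} u∈ v∈ (_ , saturates) (ν , _) = decidable-stable (u ≟ v) λ u≢v →
    let e , e∈ , inc = saturates v (x∈p∩q⁺ (block⊆vertices v∈ , x∉p⇒x∈∁p λ v∈u → u≢v (sym (x∈⁅y⁆⇒x≡y u v∈u))))
    in x∈∁p⇒x∉p (within-incident {G = G} (proj₂ (induced-edge⁻ {G = block i} (areEdges ν e e∈))) inc) (x∈⁅x⁆ v)

  -- Without an edge of `M′` at the block, exposability is vacuous and every vertex may be left out.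
  count-uncovered : ∀ {M′ i} → ¬ Saturates Hᴳ M′ (n ↑ʳ i) →
                    ∑ (B i) (λ v _ → Mpm (block i − v)) ≡ count (nearPerfect? M′ i)
  count-uncovered {M′} {i} uncovered = sym (trans
    (count-∃ (B i) (λ v L → exposable? M′ i v ×-dec isPerfectMatching? (block i − v) L)
      λ u∈ v∈ (_ , pm) (_ , qm) → exposed-unique u∈ v∈ pm qm)
    (∑-cong (B i) λ v _ → count-cong (λ L → exposable? M′ i v ×-dec isPerfectMatching? (block i − v) L)
      (isPerfectMatching? (block i − v)) proj₂ λ pm → (λ e e∈ inc → ⊥-elim (uncovered (e , e∈ , inc))) , pm))

  -- With a single exposable vertex the existential in `NearPerfect` has only one possible witness.
  count-covered : ∀ {M′ i w} → w ∈ B i → Exposable M′ i w → (∀ {v} → v ∈ B i → Exposable M′ i v → v ≡ w) →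
                  Mpm (block i − w) ≡ count (nearPerfect? M′ i)
  count-covered {M′} {i} {w} w∈ w-exposable unique = count-cong (isPerfectMatching? (block i − w)) (nearPerfect? M′ i)
    (λ pm → w , w∈ , w-exposable , pm)
    (λ {L} (v , v∈ , v-exposable , pm) → subst (λ u → IsPerfectMatching (block i − u) L) (unique v∈ v-exposable) pm)

  endIn-cross : ∀ {e a d i} → Cross e a d i → endIn G B i e ≡ d
  endIn-cross {e} {i = i} c with proj₁ (ends G e) ∈? B i
  endIn-cross (inj₁ refl , a∈ , d∈) | yes a∈B = ⊥-elim (A∌D a∈ (block⊆D a∈B))
  endIn-cross (inj₁ refl , a∈ , d∈) | no _    = refl
  endIn-cross (inj₂ refl , a∈ , d∈) | yes _   = refl
  endIn-cross (inj₂ refl , a∈ , d∈) | no d∉B  = ⊥-elim (d∉B d∈)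

  private
    -- The index is one less than in `E`: piece `zero` there is `H`, which is split off separately
    -- as `M′`.
    Q : Subset m → Fin (suc r) → Subset m → Set
    Q M′ zero    = IsPerfectMatching (G [ Cᴳ ])
    Q M′ (suc i) = NearPerfect M′ i

    Q? : ∀ M′ c → Decidable (Q M′ c)
    Q? M′ zero    = isPerfectMatching? (G [ Cᴳ ])
    Q? M′ (suc i) = nearPerfect? M′ i

    Q⊆E : ∀ M′ {c p} → Q M′ c p → p ⊆ E (suc c)
    Q⊆E M′ {zero}  (μ , _)               e∈ = areEdges μ _ e∈
    Q⊆E M′ {suc i} (v , _ , _ , (μ , _)) e∈ = proj₁ (induced-edge⁻ {G = block i} (areEdges μ _ e∈))

    rest? : ∀ M′ → Decidable (Piecewise (E ∘ suc) {Q M′})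
    rest? M′ = piecewise? (E ∘ suc) (Q? M′)

    avoids-H : ∀ {M′ q} → Piecewise (E ∘ suc) {Q M′} q → q ⊆ ∁ (edges Hᴳ)
    avoids-H (cov , _) e∈ = let c , e∈E = cov _ e∈ in
      x∉p⇒x∈∁p λ e∈H → 0≢1+n (cong toℕ (E-disjoint {zero} {suc c} e∈H e∈E))

    split : ∀ {M} → IsMaximumMatching G M → Piecewise (E ∘ suc) {Q (M ∩ edges Hᴳ)} (M ∩ ∁ (edges Hᴳ))
    split {M} M-max = Covered-rest E E-disjoint M covered , λ c → subst (Q _ c) (sym (∩-rest E E-disjoint M c)) (piece c)
      where
      open Decomposed (maximum⇒decomposed M-max)
      piece : ∀ c → Q (M ∩ edges Hᴳ) c (M ∩ E (suc c))
      piece zero    = atC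
      piece (suc i) = atB i

    join : ∀ {M} → IsMaximumMatching Hᴳ (M ∩ edges Hᴳ) →
           Piecewise (E ∘ suc) {Q (M ∩ edges Hᴳ)} (M ∩ ∁ (edges Hᴳ)) → IsMaximumMatching G M
    join {M} atH (cov , q) = decomposed⇒maximum record
      { covered = Covered-merge E M cov
      ; atH = atH
      ; atC = piece zero
      ; atB = λ i → piece (suc i)
      }
      where
      piece : ∀ c → Q (M ∩ edges Hᴳ) c (M ∩ E (suc c))
      piece c = subst (Q _ c) (∩-rest E E-disjoint M c) (q c)

  coveredBlock? : ∀ M′ i → Dec (Saturates Hᴳ M′ (n ↑ʳ i))
  coveredBlock? M′ i = saturates? Hᴳ M′ (n ↑ʳ i)

  coverer : ∀ M′ i → i ∈ ⟪ coveredBlock? M′ ⟫ → Fin n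
  coverer M′ i i∈ = endIn G B i (proj₁ (∈⟪⟫⁻ (coveredBlock? M′) i∈))

  -- It has the shape of the summand in the theorem, so that instantiating the abstract partition
  -- gives the stated formula by unfolding.
  summand : Subset m → ℕ
  summand M′ = ∏ ⟪ coveredBlock? M′ ⟫ (λ i i∈ → Mpm (block i − coverer M′ i i∈))
             * ∏ (∁ ⟪ coveredBlock? M′ ⟫) (λ i _ → ∑ (B i) (λ v _ → Mpm (block i − v)))

  summand≡ : ∀ {M′} → IsMatching Hᴳ M′ → summand M′ ≡ ∏ ⊤ (λ i _ → count (nearPerfect? M′ i))
  summand≡ {M′} μ = ∏-merge ⟪ coveredBlock? M′ ⟫
    (λ i i∈ → covered i (∈⟪⟫⁻ (coveredBlock? M′) i∈))
    (λ i i∈ → count-uncovered λ sat → x∈∁p⇒x∉p i∈ (∈⟪⟫⁺ (coveredBlock? M′) sat))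
    where
    covered : ∀ i (sat : Saturates Hᴳ M′ (n ↑ʳ i)) →
              Mpm (block i − endIn G B i (proj₁ sat)) ≡ count (nearPerfect? M′ i)
    covered i (e , e∈ , e-i) with ∈H⇒cross (areEdges μ e e∈)
    ... | a , d , j , c@(e-ad , a∈ , d∈) with crossing-block c e-i
    ... | refl rewrite endIn-cross c = count-covered d∈
      -- As `M′` is a matching, `e` is its only edge at this block, so `d` is exposable. Conversely,
      -- exposability applied to `e` forces any exposable vertex to be `d`.
      (λ f f∈ f-i → subst (λ g → Incident G g d) (disjoint μ e f e∈ f∈ _ e-i f-i) (joins⇒incidentʳ {F = G} {e = e} e-ad))
      (λ v∈ v-exposable → crossing-incident c (v-exposable e e∈ e-i) (block⊆D v∈))

  Mmax-formula : Mmax G ≡ Mpm (G [ Cᴳ ]) * sum (map summand (maximumMatchings Hᴳ))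
  Mmax-formula = begin
    Mmax G
      ≡⟨ count-split (isMaximumMatching? G) (isMaximumMatching? Hᴳ) rest? (edges Hᴳ)
           (λ (μ , _) e∈ → areEdges μ _ e∈) (λ {p} → avoids-H {p})
           (λ M-max → Decomposed.atH (maximum⇒decomposed M-max)) split join ⟩
    sum (map (λ M′ → count (rest? M′)) (maximumMatchings Hᴳ))
      -- The product form is proved only for matchings of `H`, so the rewriting uses that the
      -- members of the list are such.
      ≡⟨ cong sum (map-cong-local (All.map pieces (all-filter (isMaximumMatching? Hᴳ) (subsets m)))) ⟩
    sum (map (λ M′ → Mpm (G [ Cᴳ ]) * summand M′) (maximumMatchings Hᴳ))
      ≡⟨ sum-map-* (Mpm (G [ Cᴳ ])) summand (maximumMatchings Hᴳ) ⟩
    Mpm (G [ Cᴳ ]) * sum (map summand (maximumMatchings Hᴳ)) ∎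
    where
    open ≡-Reasoning
    pieces : ∀ {M′} → IsMaximumMatching Hᴳ M′ → count (rest? M′) ≡ Mpm (G [ Cᴳ ]) * summand M′
    pieces {M′} (μ , _) = trans
      (count-piecewise (E ∘ suc) (Q? M′) (λ x∈ y∈ → suc-injective (E-disjoint x∈ y∈)) (λ {c} → Q⊆E M′ {c}))
      (cong (Mpm (G [ Cᴳ ]) *_) (sym (summand≡ μ)))

theorem2p4 : ∀ {n m r : ℕ} (G : Graph n m) (B : Fin r → Subset n) →
    IsComponentList (G [ D G ]) B →
    Mmax G ≡
    Mpm (G [ C G ]) *
    sum (map (λ M′ →
    ∏ (I G B M′) (λ i i∈I → Mpm ((G [ D G ] [ B i ]) − w G B M′ i i∈I))
    * ∏ (∁ (I G B M′)) (λ i _ →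
    ∑ (B i) (λ v _ → Mpm ((G [ D G ] [ B i ]) − v))))
    (maximumMatchings (H G B)))
theorem2p4 G B components = Decomposition.Mmax-formula (gallaiEdmonds G) components
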